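{- Let $q$ be a prime power, and let $n, k, m$ be integers with $n/2 < k < n$ and $1 \leq m \leq q^k$. Let $S \subseteq \mathbb{F}_q^n$. Let $L$ be a set of $k$-flats in $\mathbb{F}_q^n$ that each contain at least $m$ points of $S$, with $|L| = \binom{n}{k}_q$. Then $$|S| \geq \left(1 - q^{n-2k} - \sqrt{q^{n-k} m^{ -1}}\right) m\, q^{n-k}.$$ In particular, the same lower bound holds for $K(q,n,k,m)$, i.e. $K(q,n,k,m) \geq \left(1 - q^{n-2k} - \sqrt{q^{n-k} m^{ -1}}\right) m\, q^{n-k}$.
   Context: $\mathbb{F}_q$ is the finite field with $q$ elements. A $k$-flat in $\mathbb{F}_q^n$ is a translate of a $k$-dimensional linear subspace. $\binom{n}{k}_q = \frac{(1-q^n)(1-q^{n-1})\cdots(1-q^{n-k+1})}{(1-q)(1-q^2)\cdots(1-q^k)}$ is the $q$-binomial coefficient, equal to the number of $k$-dimensional linear subspaces of $\mathbb{F}_q^n$. The flats in $L$ are not assumed to have different directions. For integers $1 \leq k < n$ and $m \geq 1$, a subset $S \subseteq \mathbb{F}_q^n$ is a $(k,m)$-Furstenberg set if for each $k$-dimensional linear subspace $W$ of $\mathbb{F}_q^n$ there is a translate of $W$ that intersects $S$ in at least $m$ points. For $1 \leq k < n$ and $m \leq q^k$, $K(q,n,k,m)$ denotes the least $t$ such that there exists a $(k,m)$-Furstenberg set in $\mathbb{F}_q^n$ of cardinality $t$. -}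

module Defs where

open import Algebra.Core using (Op₁; Op₂)
open import Algebra.Structures using (IsCommutativeRing)
open import Data.Integer as ℤ using (ℤ; -[1+_]; _⊖_)
open import Data.List using (length; applyUpTo)
open import Data.List.Membership.Propositional using (_∈_)
open import Data.List.Relation.Unary.All using (All)
open import Data.List.Relation.Unary.All.Properties using (applyUpTo⁺₂)
open import Data.List.Relation.Unary.Unique.Propositional using (Unique)
open import Data.Fin using (Fin)
open import Data.Nat as ℕ using (ℕ; suc; _∸_; _^_; NonZero; NonTrivial)
open import Data.Nat.ListAction using (product)
open import Data.Nat.ListAction.Properties using (product≢0)
import Data.Nat.Properties as ℕ
open import Data.Nat.Primality using (Prime; prime⇒nonTrivial)
open import Data.Product using (_×_; _,_; ∃; ∃-syntax)
open import Data.Rational as ℚ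
  using (ℚ; 0ℚ; 1ℚ; _<_; _≤_; _+_; _-_; _*_; -_; _/_; 1/_; Positive; NonNegative)
import Data.Rational.Properties as ℚ
open import Data.Sum using (_⊎_; inj₁; inj₂)
open import Data.Vec using (Vec; []; _∷_; zipWith; map; replicate)
open import Function.Bundles using (_↔_; _⇔_)
open import Level using (0ℓ)
open import Relation.Binary.PropositionalEquality
  using (_≡_; _≢_; refl; sym; trans; cong; subst; module ≡-Reasoning)
open import Relation.Nullary using (¬_; yes; no)
open import Relation.Unary using (Pred; _≐_; _∩_; _⊆_)
open import Algebra.Properties.Group ℚ.+-0-group using (⁻¹-involutive)

record PrimePower (q : ℕ) : Set where
  field
    {base exponent} : ℕ
    base-prime      : Prime base
    exponent≥1      : 1 ℕ.≤ exponent
    q≡base^exponent : q ≡ base ^ exponent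

primePower⇒nonTrivial : ∀ {q} → PrimePower q → NonTrivial q
primePower⇒nonTrivial {q} pp = ℕ.n>1⇒nonTrivial (begin-strict
  1                ≡⟨⟩
  base ^ 0         <⟨ ℕ.^-monoʳ-< base 1<base exponent≥1 ⟩
  base ^ exponent  ≡⟨ q≡base^exponent ⟨
  q                ∎)
  where
  open PrimePower pp
  open ℕ.≤-Reasoning
  1<base : 1 ℕ.< base
  1<base = ℕ.nonTrivial⇒n>1 base {{prime⇒nonTrivial base-prime}}

-- Both the numerator and the denominator of the usual formula have k factors
-- 1 - qʲ; they are negated here so as to stay in ℕ.  For k ≤ n the quotient is
-- an integer, so the division is exact.

qBinomial : (q n k : ℕ) → .{{NonTrivial q}} → ℕ
qBinomial q n k = (numerator ℕ./ denominator) {{denominator≢0}}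
  where
  numerator denominator : ℕ
  numerator   = product (applyUpTo (λ i → q ^ (n ∸ i) ∸ 1) k)
  denominator = product (applyUpTo (λ i → q ^ suc i ∸ 1) k)

  factor≢0 : ∀ i → NonZero (q ^ suc i ∸ 1)
  factor≢0 i = ℕ.>-nonZero
    (ℕ.m<n⇒0<n∸m (ℕ.^-monoʳ-< q (ℕ.nonTrivial⇒n>1 q) (ℕ.z<s {i})))

  denominator≢0 : NonZero denominator
  denominator≢0 = product≢0 (applyUpTo⁺₂ _ k factor≢0)

record FiniteField (q : ℕ) : Set₁ where
  infixl 6 _⊕_
  infixl 7 _⊗_
  field
    Carrier           : Set
    _⊕_ _⊗_           : Op₂ Carrier
    ⊝_                : Op₁ Carrier
    0# 1#             : Carrier
    isCommutativeRing : IsCommutativeRing _≡_ _⊕_ _⊗_ ⊝_ 0# 1#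
    0#≢1#             : 0# ≢ 1#
    inverse           : ∀ x → x ≢ 0# → ∃[ y ] x ⊗ y ≡ 1#
    enumeration       : Carrier ↔ Fin q

HasSize : {A : Set} → Pred A 0ℓ → ℕ → Set
HasSize P s = ∃[ xs ] Unique xs × length xs ≡ s × (∀ x → x ∈ xs ⇔ P x)

HasAtLeast : {A : Set} → Pred A 0ℓ → ℕ → Set
HasAtLeast P m = ∃[ xs ] Unique xs × length xs ≡ m × All P xs

module _ {q : ℕ} (F : FiniteField q) where
  open FiniteField F

  Point : ℕ → Set
  Point n = Vec Carrier n

  PointSet : ℕ → Set₁
  PointSet n = Pred (Point n) 0ℓ

  infixl 6 _+ᵛ_
  infixr 7 _·ᵛ_

  0ᵛ : ∀ {n} → Point n
  0ᵛ = replicate _ 0#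

  _+ᵛ_ : ∀ {n} → Point n → Point n → Point n
  _+ᵛ_ = zipWith _⊕_

  _·ᵛ_ : ∀ {n} → Carrier → Point n → Point n
  c ·ᵛ v = map (c ⊗_) v

  linearCombination : ∀ {n k} → Vec Carrier k → Vec (Point n) k → Point n
  linearCombination []       []       = 0ᵛ
  linearCombination (c ∷ cs) (v ∷ vs) = c ·ᵛ v +ᵛ linearCombination cs vs

  LinearlyIndependent : ∀ {n k} → Vec (Point n) k → Set
  LinearlyIndependent {k = k} vs =
    ∀ cs → linearCombination cs vs ≡ 0ᵛ → cs ≡ replicate k 0#

  record IsSubspace {n : ℕ} (k : ℕ) (W : PointSet n) : Set where
    field
      0ᵛ-mem             : W 0ᵛ
      +ᵛ-closed          : ∀ {u v} → W u → W v → W (u +ᵛ v)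
      ·ᵛ-closed          : ∀ c {v} → W v → W (c ·ᵛ v)
      basis              : Vec (Point n) k
      basis-independent  : LinearlyIndependent basis
      basis-spans        : W ≐ λ v → ∃[ cs ] v ≡ linearCombination cs basis

  translate : ∀ {n} → Point n → PointSet n → PointSet n
  translate a W x = ∃[ w ] W w × x ≡ a +ᵛ w

  IsFlat : ∀ {n} → ℕ → PointSet n → Set₁
  IsFlat k A = ∃[ a ] ∃[ W ] IsSubspace k W × A ≐ translate a W

  IsFurstenberg : ∀ {n} → ℕ → ℕ → PointSet n → Set₁
  IsFurstenberg k m S =
    ∀ W → IsSubspace k W → ∃[ a ] HasAtLeast (translate a W ∩ S) m

  -- The relation K(q,n,k,m) = t.

  record IsK (n k m t : ℕ) : Set₁ where
    field
      attained : ∃[ S ] HasSize S t × IsFurstenberg {n} k m S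
      minimal  : ∀ {s} (S : PointSet n) →
                 HasSize S s → IsFurstenberg k m S → t ℕ.≤ s

record ℝ : Set₁ where
  field
    Lower Upper     : Pred ℚ 0ℓ
    lower-inhabited : ∃ Lower
    upper-inhabited : ∃ Upper
    lower-closed    : ∀ {r s} → r < s → Lower s → Lower r
    upper-closed    : ∀ {r s} → r < s → Upper r → Upper s
    lower-open      : ∀ {r} → Lower r → ∃[ s ] r < s × Lower s
    upper-open      : ∀ {s} → Upper s → ∃[ r ] r < s × Upper r
    disjoint        : ∀ {r} → Lower r → ¬ Upper r
    located         : ∀ {r s} → r < s → Lower r ⊎ Upper s

open ℝ

infix 4 _≤ᴿ_

_≤ᴿ_ : ℝ → ℝ → Set
x ≤ᴿ y = Lower x ⊆ Lower y

private
  p-1<p : ∀ p → p - 1ℚ < p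
  p-1<p p = subst (p - 1ℚ <_) (ℚ.+-identityʳ p)
    (ℚ.+-monoʳ-< p {y = 0ℚ} (ℚ.negative⁻¹ (- 1ℚ)))

  p<p+1 : ∀ p → p < p + 1ℚ
  p<p+1 p = subst (_< p + 1ℚ) (ℚ.+-identityʳ p)
    (ℚ.+-monoʳ-< p {x = 0ℚ} (ℚ.positive⁻¹ 1ℚ))

fromℚ : ℚ → ℝ
fromℚ a .Lower = _< a
fromℚ a .Upper = a <_
fromℚ a .lower-inhabited = a - 1ℚ , p-1<p a
fromℚ a .upper-inhabited = a + 1ℚ , p<p+1 a
fromℚ a .lower-closed = ℚ.<-trans
fromℚ a .upper-closed r<s a<r = ℚ.<-trans a<r r<s
fromℚ a .lower-open r<a = let s , r<s , s<a = ℚ.<-dense r<a in s , r<s , s<a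
fromℚ a .upper-open a<s = let r , a<r , r<s = ℚ.<-dense a<s in r , r<s , a<r
fromℚ a .disjoint = ℚ.<-asym
fromℚ a .located {r} r<s with r ℚ.<? a
... | yes r<a = inj₁ r<a
... | no  r≮a = inj₂ (ℚ.≤-<-trans (ℚ.≮⇒≥ r≮a) r<s)

fromℕ : ℕ → ℝ
fromℕ n = fromℚ (ℤ.+ n / 1)

private
  a-[a-p]≡p : ∀ a p → a - (a - p) ≡ p
  a-[a-p]≡p a p = begin
    a - (a - p)          ≡⟨ cong (a +_) (ℚ.neg-distrib-+ a (- p)) ⟩
    a + (- a + - (- p))  ≡⟨ ℚ.+-assoc a (- a) _ ⟨
    a - a + - (- p)      ≡⟨ cong (_+ - (- p)) (ℚ.+-inverseʳ a) ⟩
    0ℚ + - (- p)         ≡⟨ ℚ.+-identityˡ _ ⟩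
    - (- p)              ≡⟨ ⁻¹-involutive p ⟩
    p                    ∎
    where open ≡-Reasoning

  a-‿anti : ∀ a {r s} → r < s → a - s < a - r
  a-‿anti a r<s = ℚ.+-monoʳ-< a (ℚ.neg-antimono-< r<s)

  a-‿antiˡ : ∀ a {r s} → a - r < s → a - s < r
  a-‿antiˡ a {r} lt = subst (_ <_) (a-[a-p]≡p a r) (a-‿anti a lt)

  a-‿antiʳ : ∀ a {r s} → r < a - s → s < a - r
  a-‿antiʳ a {s = s} lt = subst (_< _) (a-[a-p]≡p a s) (a-‿anti a lt)

infixl 6 _-ᴿ_

_-ᴿ_ : ℚ → ℝ → ℝ
(a -ᴿ x) .Lower r = Upper x (a - r)
(a -ᴿ x) .Upper r = Lower x (a - r)
(a -ᴿ x) .lower-inhabited =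
  let u , ux = upper-inhabited x in a - u , subst (Upper x) (sym (a-[a-p]≡p a u)) ux
(a -ᴿ x) .upper-inhabited =
  let l , lx = lower-inhabited x in a - l , subst (Lower x) (sym (a-[a-p]≡p a l)) lx
(a -ᴿ x) .lower-closed r<s = upper-closed x (a-‿anti a r<s)
(a -ᴿ x) .upper-closed r<s = lower-closed x (a-‿anti a r<s)
(a -ᴿ x) .lower-open Ur =
  let u , u<a-r , Uu = upper-open x Ur
  in a - u , a-‿antiʳ a u<a-r , subst (Upper x) (sym (a-[a-p]≡p a u)) Uu
(a -ᴿ x) .upper-open Ls =
  let l , a-s<l , Ll = lower-open x Ls
  in a - l , a-‿antiˡ a a-s<l , subst (Lower x) (sym (a-[a-p]≡p a l)) Ll
(a -ᴿ x) .disjoint Ur Lr = disjoint x Lr Ur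
(a -ᴿ x) .located r<s with located x (a-‿anti a r<s)
... | inj₁ L = inj₂ L
... | inj₂ U = inj₁ U

infixl 7 _*ᴿ_

_*ᴿ_ : ℝ → (c : ℚ) → .{{Positive c}} → ℝ
x *ᴿ c = record
  { Lower           = λ r → Lower x (r * c⁻¹)
  ; Upper           = λ r → Upper x (r * c⁻¹)
  ; lower-inhabited =
      let l , Ll = lower-inhabited x in l * c , subst (Lower x) (sym (cancel l)) Ll
  ; upper-inhabited =
      let u , Uu = upper-inhabited x in u * c , subst (Upper x) (sym (cancel u)) Uu
  ; lower-closed    = λ r<s → lower-closed x (mono r<s)
  ; upper-closed    = λ r<s → upper-closed x (mono r<s)
  ; lower-open      = λ {r} Lr →
      let s , r/c<s , Ls = lower-open x Lr
      in s * c , subst (_< s * c) (cancel′ r) (ℚ.*-monoˡ-<-pos c r/c<s) ,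
         subst (Lower x) (sym (cancel s)) Ls
  ; upper-open      = λ {s} Us →
      let r , r<s/c , Ur = upper-open x Us
      in r * c , subst (r * c <_) (cancel′ s) (ℚ.*-monoˡ-<-pos c r<s/c) ,
         subst (Upper x) (sym (cancel r)) Ur
  ; disjoint        = disjoint x
  ; located         = λ r<s → located x (mono r<s)
  }
  where
  instance _ = ℚ.pos⇒nonZero c

  c⁻¹ : ℚ
  c⁻¹ = 1/ c

  mono : ∀ {r s} → r < s → r * c⁻¹ < s * c⁻¹
  mono = ℚ.*-monoˡ-<-pos c⁻¹ {{ℚ.1/pos⇒pos c}}

  cancel : ∀ r → r * c * c⁻¹ ≡ r
  cancel r = trans (ℚ.*-assoc r c c⁻¹)
    (trans (cong (r *_) (ℚ.*-inverseʳ c)) (ℚ.*-identityʳ r))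

  cancel′ : ∀ r → r * c⁻¹ * c ≡ r
  cancel′ r = trans (ℚ.*-assoc r c⁻¹ c)
    (trans (cong (r *_) (ℚ.*-inverseˡ c)) (ℚ.*-identityʳ r))

private
  square-mono-< : ∀ {r s} → 0ℚ ≤ r → r < s → r * r < s * s
  square-mono-< {r} {s} 0≤r r<s = ℚ.≤-<-trans
    (ℚ.*-monoˡ-≤-nonNeg r {{ℚ.nonNegative 0≤r}} (ℚ.<⇒≤ r<s))
    (ℚ.*-monoˡ-<-pos s {{ℚ.positive (ℚ.≤-<-trans 0≤r r<s)}} r<s)

-- Lower: the rationals strictly below some s with s² ≤ x.
-- Upper: the rationals strictly above some s ≥ 0 with x ≤ s².

√ : (x : ℚ) → .{{NonNegative x}} → ℝ
√ x = record
  { Lower           = λ r → ∃[ s ] r < s × s * s ≤ x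
  ; Upper           = λ r → ∃[ s ] s < r × 0ℚ ≤ s × x ≤ s * s
  ; lower-inhabited = 0ℚ - 1ℚ , 0ℚ , p-1<p 0ℚ , 0≤x
  ; upper-inhabited = x + 1ℚ + 1ℚ , x + 1ℚ , p<p+1 _ , 0≤x+1 , x≤[x+1]²
  ; lower-closed    = λ { r<s (t , s<t , t²≤x) → t , ℚ.<-trans r<s s<t , t²≤x }
  ; upper-closed    = λ { r<s (t , t<r , h) → t , ℚ.<-trans t<r r<s , h }
  ; lower-open      = λ { (t , r<t , h) →
      let s , r<s , s<t = ℚ.<-dense r<t in s , r<s , t , s<t , h }
  ; upper-open      = λ { (t , t<s , h) →
      let r , t<r , r<s = ℚ.<-dense t<s in r , r<s , t , t<r , h }
  ; disjoint        = λ { (s , r<s , s²≤x) (t , t<r , 0≤t , x≤t²) →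
      ℚ.<-irrefl refl (ℚ.<-≤-trans
        (square-mono-< 0≤t (ℚ.<-trans t<r r<s)) (ℚ.≤-trans s²≤x x≤t²)) }
  ; located         = loc
  }
  where
  0≤x : 0ℚ ≤ x
  0≤x = ℚ.nonNegative⁻¹ x

  0≤x+1 : 0ℚ ≤ x + 1ℚ
  0≤x+1 = ℚ.≤-trans 0≤x (ℚ.<⇒≤ (p<p+1 x))

  x≤[x+1]² : x ≤ (x + 1ℚ) * (x + 1ℚ)
  x≤[x+1]² = ℚ.≤-trans (ℚ.<⇒≤ (p<p+1 x)) (subst (_≤ (x + 1ℚ) * (x + 1ℚ))
    (ℚ.*-identityʳ (x + 1ℚ))
    (ℚ.*-monoˡ-≤-nonNeg (x + 1ℚ) {{ℚ.nonNegative 0≤x+1}}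
      (subst (_≤ x + 1ℚ) (ℚ.+-identityˡ 1ℚ) (ℚ.+-monoˡ-≤ 1ℚ 0≤x))))

  loc : ∀ {r s} → r < s →
        (∃[ t ] r < t × t * t ≤ x) ⊎ (∃[ t ] t < s × 0ℚ ≤ t × x ≤ t * t)
  loc r<s with ℚ.<-dense r<s
  ... | t , r<t , t<s with t ℚ.<? 0ℚ
  ...   | yes t<0 = inj₁ (0ℚ , ℚ.<-trans r<t t<0 , 0≤x)
  ...   | no  t≮0 with ℚ.≤-total (t * t) x
  ...     | inj₁ t²≤x = inj₁ (t , r<t , t²≤x)
  ...     | inj₂ x≤t² = inj₂ (t , t<s , ℚ.≮⇒≥ t≮0 , x≤t²)

infixr 8 _^ᶻ_

_^ᶻ_ : (a : ℕ) → ℤ → .{{NonZero a}} → ℚ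
a ^ᶻ (ℤ.+ e)    = ℤ.+ (a ^ e) / 1
a ^ᶻ -[1+ e ] = (ℤ.+ 1 / (a ^ suc e)) {{ℕ.m^n≢0 a (suc e)}}

^ᶻ-positive : ∀ a e → .{{_ : NonZero a}} → Positive (a ^ᶻ e)
^ᶻ-positive a (ℤ.+ e)    = ℚ.normalize-pos (a ^ e) 1 {{_}} {{ℕ.m^n≢0 a e}}
^ᶻ-positive a -[1+ e ] = ℚ.normalize-pos 1 (a ^ suc e) {{ℕ.m^n≢0 a (suc e)}}

-- (1 - qⁿ⁻²ᵏ - √(qⁿ⁻ᵏ m⁻¹)) m qⁿ⁻ᵏ; here i ⊖ j is the integer i - j.

furstenbergBound : (q n k m : ℕ) → .{{NonTrivial q}} → .{{NonZero m}} → ℝ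
furstenbergBound q n k m =
  (1ℚ - q ^ᶻ (n ⊖ 2 ℕ.* k) -ᴿ √ (q ^ᶻ (n ⊖ k) * (ℤ.+ 1 / m)))
    *ᴿ ((ℤ.+ m / 1) * q ^ᶻ (n ⊖ k))
  where
  instance
    q≢0 : NonZero q
    q≢0 = ℕ.nonTrivial⇒nonZero q

    qⁿ⁻ᵏ>0 : Positive (q ^ᶻ (n ⊖ k))
    qⁿ⁻ᵏ>0 = ^ᶻ-positive q (n ⊖ k)

    m>0 : Positive (ℤ.+ m / 1)
    m>0 = ℚ.normalize-pos m 1

    m⁻¹>0 : Positive (ℤ.+ 1 / m)
    m⁻¹>0 = ℚ.normalize-pos 1 m

    radicand>0 : Positive (q ^ᶻ (n ⊖ k) * (ℤ.+ 1 / m))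
    radicand>0 = ℚ.pos*pos⇒pos (q ^ᶻ (n ⊖ k)) (ℤ.+ 1 / m)

    radicand≥0 : NonNegative (q ^ᶻ (n ⊖ k) * (ℤ.+ 1 / m))
    radicand≥0 = ℚ.pos⇒nonNeg (q ^ᶻ (n ⊖ k) * (ℤ.+ 1 / m))

    factor>0 : Positive ((ℤ.+ m / 1) * q ^ᶻ (n ⊖ k))
    factor>0 = ℚ.pos*pos⇒pos (ℤ.+ m / 1) (q ^ᶻ (n ⊖ k))

module Submission where

-- Write K = q^k, D = q^(n-k) and Q = K D = q^n, and let s be the size of S.
-- The proof is a second-moment estimate for the number of points of S on a
-- random k-flat.  Instead of flats it counts frames: pairs of a linearly
-- independent k-tuple vs (a basis of the direction) and a point a.  The frame
-- spans the flat a + span vs, and every k-flat is spanned by the same number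
-- of frames.
--
-- Fix vs, and let X(a) be the number of points of S on the flat of (vs, a).
-- Summing over a, the first moment of X is K s, and the second moment is K
-- times the number of pairs of points of S whose difference lies in span vs.
-- The essential count is that, for w different from 0, at most a fraction K/Q
-- of all bases vs has w in its span (spanCount-bound): an independent tuple
-- either spans w or can be extended by w, and the tuples of the second kind
-- are counted by choosing their vectors one at a time after w.  With G
-- denoting the number of bases, this yields (∑-deviation²-bound)
--
--   sum over all frames of (D X - s)^2  ≤  K G D^2 s.
--
-- If a family of at least K G distinct frames has X ≥ m throughout, then each
-- of its members contributes at least (D m - s)^2 when s ≤ D m, so
-- (D m - s)^2 ≤ D^2 s (deviation-bound).  For s < D m the right side is less
-- than D^3 m, and dividing by (D m)^2 gives (1 - s/(D m))^2 < D/m, that is,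
-- s > (1 - √(D/m)) m D.  For s ≥ D m the bound is immediate, and subtracting
-- the positive term q^(n-2k) only lowers the bound
-- (small-deviation⇒bound).
--
-- It remains to find K G distinct frames with X ≥ m.  Each of the flats of L is
-- spanned by K g frames, where g is the number of bases of a k-space; frames of
-- different flats are different; and the q-binomial coefficient times g is G
-- (qBinomial-tupleCount).  For a Furstenberg set, each of the G bases vs comes
-- with a translate of span vs that has m points in S, and all K points of the
-- translate serve as a.

open import Defs
open import Algebra.Bundles using (CommutativeRing; AbelianGroup)
import Algebra.Properties.Group as GroupProperties
open import Data.Fin as Fin using (Fin)
import Data.Integer as ℤ
import Data.Integer.Properties as ℤ
open import Data.List using (List; []; _∷_; length; map; filter; _++_; _∷ʳ_; allFin; applyUpTo; cartesianProductWith)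
open import Data.List.Membership.Propositional using (_∈_)
open import Data.List.Membership.Propositional.Properties
  using (∈-∃++; ∈-++⁺ˡ; ∈-++⁺ʳ; ∈-++⁻; ∈-map⁺; ∈-map⁻; ∈-allFin; ∈-filter⁺; ∈-filter⁻;
         ∈-cartesianProductWith⁺; ∈-cartesianProductWith⁻)
import Data.List.Properties as List
open import Data.List.Relation.Unary.All as All using (All; []; _∷_)
import Data.List.Relation.Unary.All.Properties as All
open import Data.List.Relation.Unary.AllPairs as AllPairs using (AllPairs; []; _∷_)
open import Data.List.Relation.Unary.Any as Any using (Any; here; there)
open import Data.List.Relation.Unary.Unique.Propositional using () renaming (Unique to Unique≡)
import Data.List.Relation.Unary.Unique.Propositional.Properties as Unique≡
open import Data.List.Relation.Unary.Unique.Setoid using (Unique)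
open import Data.Nat
  using (ℕ; zero; suc; _+_; _*_; _∸_; _^_; ∣_-_∣; _≤_; _<_; z≤n; s≤s; z<s; NonZero; NonTrivial;
         >-nonZero; nonTrivial⇒nonZero; nonTrivial⇒n>1)
open import Data.Nat.DivMod using (m/n*n≡m)
open import Data.Nat.Divisibility using (_∣_; _∣0; ∣m∣n⇒∣m+n; ∣n⇒∣m*n; *-monoˡ-∣; ∣-refl)
open import Data.Nat.ListAction using (sum; product)
open import Data.Nat.ListAction.Properties using (sum-++; product-++; product≢0)
open import Data.Nat.Properties hiding (_≟_)
open import Data.Nat.Tactic.RingSolver using (solve-∀)
open import Data.Product using (_×_; _,_; ∃-syntax; proj₁; proj₂)
open import Data.Rational as ℚ using (ℚ; 0ℚ; 1ℚ; _/_; 1/_; Positive; NonNegative; toℚᵘ)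
  renaming (_+_ to _+ℚ_; _-_ to _-ℚ_; _*_ to _*ℚ_; _<_ to _<ℚ_; _≤_ to _≤ℚ_)
import Data.Rational.Properties as ℚ
open import Data.Rational.Solver using (module +-*-Solver)
open import Data.Rational.Unnormalised as ℚᵘ using (mkℚᵘ)
import Data.Rational.Unnormalised.Properties as ℚᵘ
open import Data.Sum using (inj₁; inj₂)
open import Data.Vec as Vec using (Vec; []; _∷_)
import Data.Vec.Properties as Vec
open import Function using (_∘_; _↔_; Inverse; _⇔_; Equivalence)
open import Function.Properties.Inverse using (↔⇒↣)
open import Level using (Level; 0ℓ)
open import Relation.Binary.Definitions using (DecidableEquality)
open import Relation.Binary.PropositionalEquality
open import Relation.Nullary using (Dec; yes; no; ¬_; contradiction)
open import Relation.Nullary.Decidable using (map′; _→-dec_; via-injection)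
open import Relation.Unary using (_∩_; _≐_)
open import Relation.Unary.Properties using (≐-trans; ≐-sym)
open import Relation.Unary.Relation.Binary.Equality using (≐-setoid)

private
  variable
    ℓ : Level
    A B : Set

-- Finite sums over lists

∑ : List A → (A → ℕ) → ℕ
∑ xs f = sum (map f xs)

infixr 8 ∑
syntax ∑ xs (λ x → e) = ∑[ x ∈ xs ] e

-- The indicator of a decidable proposition.

⟦_⟧ : {P : Set} → Dec P → ℕ
⟦ yes _ ⟧ = 1
⟦ no  _ ⟧ = 0

⟦yes⟧ : {P : Set} (P? : Dec P) → P → ⟦ P? ⟧ ≡ 1
⟦yes⟧ (yes _) p = refl
⟦yes⟧ (no ¬p) p = contradiction p ¬p

⟦no⟧ : {P : Set} (P? : Dec P) → ¬ P → ⟦ P? ⟧ ≡ 0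
⟦no⟧ (yes p) ¬p = contradiction p ¬p
⟦no⟧ (no _) ¬p = refl

⟦⟧-cong : ∀ {P P′ : Set} (P? : Dec P) (P′? : Dec P′) → (P → P′) → (P′ → P) → ⟦ P? ⟧ ≡ ⟦ P′? ⟧
⟦⟧-cong (yes p) P′? f g = sym (⟦yes⟧ P′? (f p))
⟦⟧-cong (no ¬p) P′? f g = sym (⟦no⟧ P′? (¬p ∘ g))

∑-cong : ∀ (xs : List A) {f g : A → ℕ} → (∀ x → f x ≡ g x) → ∑ xs f ≡ ∑ xs g
∑-cong xs f≗g = cong sum (List.map-cong f≗g xs)

∑-mono-∈ : ∀ (xs : List A) {f g : A → ℕ} → (∀ {x} → x ∈ xs → f x ≤ g x) → ∑ xs f ≤ ∑ xs g
∑-mono-∈ []       f≤g = z≤n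
∑-mono-∈ (x ∷ xs) f≤g = +-mono-≤ (f≤g (here refl)) (∑-mono-∈ xs (f≤g ∘ there))

∑-mono : ∀ (xs : List A) {f g : A → ℕ} → (∀ x → f x ≤ g x) → ∑ xs f ≤ ∑ xs g
∑-mono xs f≤g = ∑-mono-∈ xs (λ {x} _ → f≤g x)

∑-cong-∈ : ∀ (xs : List A) {f g : A → ℕ} → (∀ {x} → x ∈ xs → f x ≡ g x) → ∑ xs f ≡ ∑ xs g
∑-cong-∈ xs f≗g = ≤-antisym (∑-mono-∈ xs (≤-reflexive ∘ f≗g)) (∑-mono-∈ xs (≤-reflexive ∘ sym ∘ f≗g))

∑-const : ∀ (xs : List A) c → ∑[ _ ∈ xs ] c ≡ length xs * c
∑-const []       c = refl
∑-const (x ∷ xs) c = cong (c +_) (∑-const xs c)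

∑-zero : ∀ (xs : List A) {f : A → ℕ} → (∀ x → f x ≡ 0) → ∑ xs f ≡ 0
∑-zero xs f≡0 = trans (∑-cong xs f≡0) (trans (∑-const xs 0) (*-zeroʳ (length xs)))

∑-distrib-+ : ∀ (xs : List A) (f g : A → ℕ) → ∑[ x ∈ xs ] (f x + g x) ≡ ∑ xs f + ∑ xs g
∑-distrib-+ []       f g = refl
∑-distrib-+ (x ∷ xs) f g = trans (cong (f x + g x +_) (∑-distrib-+ xs f g)) (lemma (f x) _ _ _)
  where
  lemma : ∀ a b c d → a + b + (c + d) ≡ a + c + (b + d)
  lemma = solve-∀

∑-distribˡ-* : ∀ (xs : List A) c (f : A → ℕ) → ∑[ x ∈ xs ] (c * f x) ≡ c * ∑ xs f
∑-distribˡ-* []       c f = sym (*-zeroʳ c)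
∑-distribˡ-* (x ∷ xs) c f =
  trans (cong (c * f x +_) (∑-distribˡ-* xs c f)) (sym (*-distribˡ-+ c (f x) _))

∑-distribʳ-* : ∀ (xs : List A) c (f : A → ℕ) → ∑[ x ∈ xs ] (f x * c) ≡ ∑ xs f * c
∑-distribʳ-* xs c f = begin
  ∑[ x ∈ xs ] (f x * c)  ≡⟨ ∑-cong xs (λ x → *-comm (f x) c) ⟩
  ∑[ x ∈ xs ] (c * f x)  ≡⟨ ∑-distribˡ-* xs c f ⟩
  c * ∑ xs f             ≡⟨ *-comm c _ ⟩
  ∑ xs f * c             ∎
  where open ≡-Reasoning

∑-swap : ∀ (xs : List A) (ys : List B) (f : A → B → ℕ) →
         ∑[ x ∈ xs ] ∑[ y ∈ ys ] f x y ≡ ∑[ y ∈ ys ] ∑[ x ∈ xs ] f x y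
∑-swap []       ys f = sym (trans (∑-const ys 0) (*-zeroʳ (length ys)))
∑-swap (x ∷ xs) ys f =
  trans (cong (∑ ys (f x) +_) (∑-swap xs ys f)) (sym (∑-distrib-+ ys (f x) _))

∑-++ : ∀ (xs ys : List A) (f : A → ℕ) → ∑ (xs ++ ys) f ≡ ∑ xs f + ∑ ys f
∑-++ xs ys f = trans (cong sum (List.map-++ f xs ys)) (sum-++ (map f xs) (map f ys))

∑-map : ∀ (g : A → B) (xs : List A) (f : B → ℕ) → ∑ (map g xs) f ≡ ∑[ x ∈ xs ] f (g x)
∑-map g xs f = cong sum (sym (List.map-∘ xs))

∑-cartesianProductWith : ∀ {C : Set} (h : A → B → C) xs ys (f : C → ℕ) →
  ∑ (cartesianProductWith h xs ys) f ≡ ∑[ x ∈ xs ] ∑[ y ∈ ys ] f (h x y)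
∑-cartesianProductWith h []       ys f = refl
∑-cartesianProductWith h (x ∷ xs) ys f =
  trans (∑-++ (map (h x) ys) _ f) (cong₂ _+_ (∑-map (h x) ys f) (∑-cartesianProductWith h xs ys f))

∑-filter : ∀ {P : A → Set} (P? : ∀ x → Dec (P x)) xs (f : A → ℕ) →
  ∑ (filter P? xs) f ≡ ∑[ x ∈ xs ] (⟦ P? x ⟧ * f x)
∑-filter P? []       f = refl
∑-filter P? (x ∷ xs) f with P? x
... | yes _ = cong₂ _+_ (sym (*-identityˡ (f x))) (∑-filter P? xs f)
... | no  _ = ∑-filter P? xs f

length≡∑1 : (xs : List A) → length xs ≡ ∑[ _ ∈ xs ] 1
length≡∑1 xs = sym (trans (∑-const xs 1) (*-identityʳ _))

∑-⊆ : ∀ {xs ys : List A} (f : A → ℕ) → Unique≡ xs → (∀ {x} → x ∈ xs → x ∈ ys) → ∑ xs f ≤ ∑ ys f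
∑-⊆ {xs = []} f _ _ = z≤n
∑-⊆ {xs = x ∷ xs} f (x∉xs ∷ uxs) xs⊆ys with ∈-∃++ (xs⊆ys (here refl))
... | as , bs , refl = begin
  f x + ∑ xs f             ≤⟨ +-monoʳ-≤ (f x) (∑-⊆ f uxs tail⊆) ⟩
  f x + ∑ (as ++ bs) f     ≡⟨ cong (f x +_) (∑-++ as bs f) ⟩
  f x + (∑ as f + ∑ bs f)  ≡⟨ lemma (f x) (∑ as f) (∑ bs f) ⟩
  ∑ as f + (f x + ∑ bs f)  ≡⟨ ∑-++ as (x ∷ bs) f ⟨
  ∑ (as ++ x ∷ bs) f       ∎
  where
  open ≤-Reasoning
  lemma : ∀ a b c → a + (b + c) ≡ b + (a + c)
  lemma = solve-∀
  tail⊆ : ∀ {y} → y ∈ xs → y ∈ as ++ bs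
  tail⊆ y∈xs with ∈-++⁻ as (xs⊆ys (there y∈xs))
  ... | inj₁ y∈as           = ∈-++⁺ˡ y∈as
  ... | inj₂ (here refl)    = contradiction refl (All.lookup x∉xs y∈xs)
  ... | inj₂ (there y∈bs)   = ∈-++⁺ʳ as y∈bs

length-⊆ : ∀ {xs ys : List A} → Unique≡ xs → (∀ {x} → x ∈ xs → x ∈ ys) → length xs ≤ length ys
length-⊆ {xs = xs} {ys} uxs xs⊆ys = subst₂ _≤_ (sym (length≡∑1 xs)) (sym (length≡∑1 ys)) (∑-⊆ _ uxs xs⊆ys)

∑-single : ∀ {xs : List A} {x₀} (f : A → ℕ) → Unique≡ xs → x₀ ∈ xs →
           (∀ {x} → x ∈ xs → x ≢ x₀ → f x ≡ 0) → ∑ xs f ≡ f x₀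
∑-single {xs = x ∷ xs} f (x∉xs ∷ _) (here refl) f≡0 =
  trans (cong (f x +_) (trans (∑-cong-∈ xs (λ y∈ → f≡0 (there y∈) (λ y≡x → All.lookup x∉xs y∈ (sym y≡x))))
                         (trans (∑-const xs 0) (*-zeroʳ (length xs)))))
        (+-identityʳ _)
∑-single {xs = x ∷ xs} f (x∉xs ∷ uxs) (there x₀∈) f≡0 =
  trans (cong (_+ ∑ xs f) (f≡0 (here refl) (All.lookup x∉xs x₀∈))) (∑-single f uxs x₀∈ (f≡0 ∘ there))

-- Finite types

-- A duplicate-free enumeration of A.  Equality is required to be decidable so
-- that membership in lists of elements is.

record Finite (A : Set) : Set where
  field
    elements : List A
    unique   : Unique≡ elements
    complete : ∀ x → x ∈ elements
    _≡?_     : DecidableEquality A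

  card : ℕ
  card = length elements

  -- A sum against the indicator of a predicate with the single witness x₀.

  ∑-indicator : ∀ {P : A → Set} (P? : ∀ x → Dec (P x)) (f : A → ℕ) {x₀} → P x₀ →
                (∀ {x} → P x → x ≡ x₀) → ∑[ x ∈ elements ] (⟦ P? x ⟧ * f x) ≡ f x₀
  ∑-indicator P? f {x₀} Px₀ only =
    trans (∑-single _ unique (complete x₀) (λ {x} _ x≢x₀ → cong (_* f x) (⟦no⟧ (P? x) (x≢x₀ ∘ only))))
          (trans (cong (_* f x₀) (⟦yes⟧ (P? x₀) Px₀)) (*-identityˡ _))

  ∑-indicator₁ : ∀ {P : A → Set} (P? : ∀ x → Dec (P x)) {x₀} → P x₀ →
                 (∀ {x} → P x → x ≡ x₀) → ∑[ x ∈ elements ] ⟦ P? x ⟧ ≡ 1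
  ∑-indicator₁ P? Px₀ only =
    trans (∑-cong elements (λ x → sym (*-identityʳ ⟦ P? x ⟧))) (∑-indicator P? (λ _ → 1) Px₀ only)

  ∑-reindex-≤ : ∀ (ϕ : A → A) → (∀ {x y} → ϕ x ≡ ϕ y → x ≡ y) → ∀ f →
                ∑[ x ∈ elements ] f (ϕ x) ≤ ∑ elements f
  ∑-reindex-≤ ϕ inj f = subst (_≤ ∑ elements f) (∑-map ϕ elements f)
    (∑-⊆ f (Unique≡.map⁺ inj unique) (λ _ → complete _))

  injective⇒surjective : ∀ (ϕ : A → A) → (∀ {x y} → ϕ x ≡ ϕ y → x ≡ y) → ∀ y → ∃[ x ] y ≡ ϕ x
  injective⇒surjective ϕ inj y with y ∈? map ϕ elements
    where open import Data.List.Membership.DecPropositional _≡?_ using (_∈?_)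
  ... | yes y∈ = let x , _ , y≡ = ∈-map⁻ ϕ y∈ in x , y≡
  ... | no  y∉ = contradiction
    (length-⊆ {xs = y ∷ map ϕ elements} {elements}
      (All.tabulate (λ z∈ y≡z → y∉ (subst (_∈ _) (sym y≡z) z∈)) ∷ Unique≡.map⁺ inj unique)
      (λ _ → complete _))
    (<⇒≱ (s≤s (≤-reflexive (sym (List.length-map ϕ elements)))))

open Finite

↔Fin⇒Finite : ∀ {q} → A ↔ Fin q → Finite A
↔Fin⇒Finite {q = q} A↔Fin = record
  { elements = map from (allFin q)
  ; unique   = Unique≡.map⁺ (λ {i} {j} eq →
      trans (sym (strictlyInverseˡ i)) (trans (cong to eq) (strictlyInverseˡ j))) (Unique≡.allFin⁺ q)
  ; complete = λ x → subst (_∈ _) (strictlyInverseʳ x) (∈-map⁺ from (∈-allFin (to x)))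
  ; _≡?_     = via-injection (↔⇒↣ A↔Fin) Fin._≟_
  }
  where
  open Inverse A↔Fin

vecFinite : Finite A → ∀ k → Finite (Vec A k)
vecFinite fin zero = record
  { elements = [] ∷ [] ; unique = [] ∷ [] ; complete = λ { [] → here refl } ; _≡?_ = Vec.≡-dec (_≡?_ fin) }
vecFinite fin (suc k) = record
  { elements = cartesianProductWith _∷_ (elements fin) (elements rest)
  ; unique   = Unique≡.cartesianProductWith⁺ _∷_ Vec.∷-injective (unique fin) (unique rest)
  ; complete = λ { (x ∷ xs) → ∈-cartesianProductWith⁺ _∷_ (complete fin x) (complete rest xs) }
  ; _≡?_     = Vec.≡-dec (_≡?_ fin)
  }
  where rest = vecFinite fin k

length-cartesianProductWith : ∀ {C : Set} (h : A → B → C) xs ys →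
  length (cartesianProductWith h xs ys) ≡ length xs * length ys
length-cartesianProductWith h xs ys = begin
  length (cartesianProductWith h xs ys)  ≡⟨ length≡∑1 (cartesianProductWith h xs ys) ⟩
  _                                      ≡⟨ ∑-cartesianProductWith h xs ys _ ⟩
  ∑[ _ ∈ xs ] ∑[ _ ∈ ys ] 1              ≡⟨ ∑-const xs _ ⟩
  length xs * ∑[ _ ∈ ys ] 1              ≡⟨ cong (length xs *_) (length≡∑1 ys) ⟨
  length xs * length ys                  ∎
  where open ≡-Reasoning

card-vec : (fin : Finite A) → ∀ k → card (vecFinite fin k) ≡ card fin ^ k
card-vec fin zero    = refl
card-vec fin (suc k) = trans (length-cartesianProductWith _∷_ (elements fin) _) (cong (card fin *_) (card-vec fin k))

-- Counting independent tuples: the formula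

-- The product of q^n - q^(j+i) over i < k: the number of ways to extend j
-- independent vectors of an n-dimensional space by k further ones to an
-- independent family.

tupleCount : (q n j k : ℕ) → ℕ
tupleCount q n j zero    = 1
tupleCount q n j (suc k) = tupleCount q n j k * (q ^ n ∸ q ^ (j + k))

tupleCount-suc : ∀ q n k → tupleCount q n 0 (suc k) ≡ (q ^ n ∸ 1) * tupleCount q n 1 k
tupleCount-suc q n zero    = *-comm 1 (q ^ n ∸ 1)
tupleCount-suc q n (suc k) = trans (cong (_* (q ^ n ∸ q ^ suc k)) (tupleCount-suc q n k)) (*-assoc (q ^ n ∸ 1) _ _)

tupleCount≢0 : ∀ {q n} → 1 < q → ∀ {k} → k ≤ n → NonZero (tupleCount q n 0 k)
tupleCount≢0 1<q {zero}  k≤n = _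
tupleCount≢0 {q} {n} 1<q {suc k} k<n =
  m*n≢0 _ _ {{tupleCount≢0 1<q (<⇒≤ k<n)}} {{>-nonZero (m<n⇒0<n∸m (^-monoʳ-< q 1<q k<n))}}

product-applyUpTo-suc : ∀ (f : ℕ → ℕ) k → product (applyUpTo f (suc k)) ≡ product (applyUpTo f k) * f k
product-applyUpTo-suc f k = begin
  product (applyUpTo f (suc k))        ≡⟨ cong product (List.applyUpTo-∷ʳ f k) ⟨
  product (applyUpTo f k ∷ʳ f k)       ≡⟨ product-++ (applyUpTo f k) (f k ∷ []) ⟩
  product (applyUpTo f k) * (f k * 1)  ≡⟨ cong (product (applyUpTo f k) *_) (*-identityʳ (f k)) ⟩
  product (applyUpTo f k) * f k        ∎
  where open ≡-Reasoning

-- q-binomial coefficients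

module GaussianBinomial (q : ℕ) {{_ : NonTrivial q}} where

  instance
    q≢0 : NonZero q
    q≢0 = nonTrivial⇒nonZero q

  -- The two products whose quotient is the q-binomial coefficient.

  numerator : ℕ → ℕ → ℕ
  numerator n k = product (applyUpTo (λ i → q ^ (n ∸ i) ∸ 1) k)

  denominator : ℕ → ℕ
  denominator k = product (applyUpTo (λ i → q ^ suc i ∸ 1) k)

  denominator≢0 : ∀ k → NonZero (denominator k)
  denominator≢0 k = product≢0 (All.applyUpTo⁺₂ _ k (λ i →
    >-nonZero (m<n⇒0<n∸m (^-monoʳ-< q (nonTrivial⇒n>1 q) (z<s {i})))))

  numerator-suc : ∀ n k → numerator n (suc k) ≡ numerator n k * (q ^ (n ∸ k) ∸ 1)
  numerator-suc n k = product-applyUpTo-suc (λ i → q ^ (n ∸ i) ∸ 1) k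

  denominator-suc : ∀ k → denominator (suc k) ≡ denominator k * (q ^ suc k ∸ 1)
  denominator-suc k = product-applyUpTo-suc (λ i → q ^ suc i ∸ 1) k

  denominator≡numerator : ∀ k → denominator k ≡ numerator k k
  denominator≡numerator zero    = refl
  denominator≡numerator (suc k) = begin
    denominator (suc k)              ≡⟨ denominator-suc k ⟩
    denominator k * (q ^ suc k ∸ 1)  ≡⟨ cong (_* (q ^ suc k ∸ 1)) (denominator≡numerator k) ⟩
    numerator k k * (q ^ suc k ∸ 1)  ≡⟨ *-comm (numerator k k) _ ⟩
    numerator (suc k) (suc k)        ∎
    where open ≡-Reasoning

  pred-^-+ : ∀ a b → q ^ (a + b) ∸ 1 ≡ q ^ a * (q ^ b ∸ 1) + (q ^ a ∸ 1)
  pred-^-+ a b = begin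
    q ^ (a + b) ∸ 1                          ≡⟨ cong (_∸ 1) (begin
      q ^ (a + b)                      ≡⟨ ^-distribˡ-+-* q a b ⟩
      q ^ a * q ^ b                    ≡⟨ cong (q ^ a *_) (m∸n+n≡m (m^n>0 q b)) ⟨
      q ^ a * (q ^ b ∸ 1 + 1)          ≡⟨ *-distribˡ-+ (q ^ a) _ 1 ⟩
      q ^ a * (q ^ b ∸ 1) + q ^ a * 1  ≡⟨ cong (q ^ a * (q ^ b ∸ 1) +_) (*-identityʳ (q ^ a)) ⟩
      q ^ a * (q ^ b ∸ 1) + q ^ a      ∎) ⟩
    q ^ a * (q ^ b ∸ 1) + q ^ a ∸ 1    ≡⟨ +-∸-assoc (q ^ a * (q ^ b ∸ 1)) (m^n>0 q a) ⟩
    q ^ a * (q ^ b ∸ 1) + (q ^ a ∸ 1)  ∎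
    where open ≡-Reasoning

  -- The q-Pascal rule with denominators cleared: divided by denominator (suc k)
  -- it expresses the (n+1, k+1) coefficient by the (n, k+1) and (n, k) ones.

  q-Pascal : ∀ {n k} → k ≤ n → numerator (suc n) (suc k) ≡
             q ^ suc k * numerator n (suc k) + numerator n k * (q ^ suc k ∸ 1)
  q-Pascal {n} {k} k≤n = begin
    (q ^ suc n ∸ 1) * x
      ≡⟨ cong (λ i → (q ^ suc i ∸ 1) * x) (m+[n∸m]≡n k≤n) ⟨
    (q ^ (suc k + (n ∸ k)) ∸ 1) * x                            ≡⟨ cong (_* x) (pred-^-+ (suc k) (n ∸ k)) ⟩
    (q ^ suc k * (q ^ (n ∸ k) ∸ 1) + (q ^ suc k ∸ 1)) * x      ≡⟨ lemma (q ^ suc k) _ _ x ⟩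
    q ^ suc k * (x * (q ^ (n ∸ k) ∸ 1)) + x * (q ^ suc k ∸ 1)
      ≡⟨ cong (λ y → q ^ suc k * y + x * (q ^ suc k ∸ 1)) (numerator-suc n k) ⟨
    q ^ suc k * numerator n (suc k) + x * (q ^ suc k ∸ 1)  ∎
    where
    open ≡-Reasoning
    x = numerator n k
    lemma : ∀ a b c x → (a * b + c) * x ≡ a * (x * b) + x * c
    lemma = solve-∀

  -- The division in qBinomial is exact, by induction along the q-Pascal rule.

  denominator∣numerator : ∀ n k → k ≤ n → denominator k ∣ numerator n k
  denominator∣numerator n       zero    _         = ∣-refl
  denominator∣numerator (suc n) (suc k) (s≤s k≤n) = subst (denominator (suc k) ∣_) (sym (q-Pascal k≤n))
    (∣m∣n⇒∣m+n (∣n⇒∣m*n (q ^ suc k) later)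
      (subst (_∣ numerator n k * (q ^ suc k ∸ 1)) (sym (denominator-suc k)) (*-monoˡ-∣ (q ^ suc k ∸ 1) (denominator∣numerator n k k≤n))))
    where
    -- For k = n the numerator contains the factor q^0 - 1 = 0.
    later : denominator (suc k) ∣ numerator n (suc k)
    later with m≤n⇒m<n∨m≡n k≤n
    ... | inj₁ k<n  = denominator∣numerator n (suc k) k<n
    ... | inj₂ refl = subst (denominator (suc k) ∣_)
      (sym (trans (numerator-suc n n) (trans (cong (λ i → numerator n n * (q ^ i ∸ 1)) (n∸n≡0 n)) (*-zeroʳ (numerator n n)))))
      (denominator (suc k) ∣0)

  -- Pulls the factor q^i out of each factor q^n - q^i.

  tupleCount≡numerator : ∀ {n} k → k ≤ n → tupleCount q n 0 k ≡ product (applyUpTo (q ^_) k) * numerator n k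
  tupleCount≡numerator     zero    k≤n = refl
  tupleCount≡numerator {n} (suc k) k<n = begin
    tupleCount q n 0 k * (q ^ n ∸ q ^ k)          ≡⟨ cong₂ _*_ (tupleCount≡numerator k (<⇒≤ k<n)) (begin
      q ^ n ∸ q ^ k
        ≡⟨ cong₂ _∸_ (trans (cong (q ^_) (sym (m+[n∸m]≡n (<⇒≤ k<n)))) (^-distribˡ-+-* q k (n ∸ k))) (sym (*-identityʳ (q ^ k))) ⟩
      q ^ k * q ^ (n ∸ k) ∸ q ^ k * 1  ≡⟨ *-distribˡ-∸ (q ^ k) _ 1 ⟨
      q ^ k * (q ^ (n ∸ k) ∸ 1)  ∎) ⟩
    (p * x) * (q ^ k * (q ^ (n ∸ k) ∸ 1))                     ≡⟨ lemma p x _ _ ⟩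
    (p * q ^ k) * (x * (q ^ (n ∸ k) ∸ 1))
      ≡⟨ cong₂ _*_ (product-applyUpTo-suc (q ^_) k) (numerator-suc n k) ⟨
    product (applyUpTo (q ^_) (suc k)) * numerator n (suc k)  ∎
    where
    open ≡-Reasoning
    p = product (applyUpTo (q ^_) k)
    x = numerator n k
    lemma : ∀ a b c d → (a * b) * (c * d) ≡ (a * c) * (b * d)
    lemma = solve-∀

  -- Choosing a k-dimensional subspace of an n-space and then a basis of it is
  -- choosing an independent k-tuple.

  qBinomial-tupleCount : ∀ {n k} → k ≤ n → qBinomial q n k * tupleCount q k 0 k ≡ tupleCount q n 0 k
  qBinomial-tupleCount {n} {k} k≤n = begin
    N * tupleCount q k 0 k   ≡⟨ cong (N *_) (tupleCount≡numerator k ≤-refl) ⟩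
    N * (p * numerator k k)  ≡⟨ cong (λ x → N * (p * x)) (denominator≡numerator k) ⟨
    N * (p * denominator k)  ≡⟨ lemma N p (denominator k) ⟩
    p * (N * denominator k)  ≡⟨ cong (p *_) (m/n*n≡m {{denominator≢0 k}} (denominator∣numerator n k k≤n)) ⟩
    p * numerator n k        ≡⟨ tupleCount≡numerator k k≤n ⟨
    tupleCount q n 0 k       ∎
    where
    open ≡-Reasoning
    N = qBinomial q n k
    p = product (applyUpTo (q ^_) k)
    lemma : ∀ a b c → a * (b * c) ≡ b * (a * c)
    lemma = solve-∀

-- Linear algebra over a finite field

module LinearAlgebra {q : ℕ} (F : FiniteField q) where

  open FiniteField F hiding (Carrier)
  open FiniteField F using () renaming (Carrier to 𝔽)

  ring : CommutativeRing 0ℓ 0ℓ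
  ring = record { isCommutativeRing = isCommutativeRing }

  module 𝔽 = CommutativeRing ring

  infixl 6 _⊞_
  infixr 7 _·_

  _⊞_ : ∀ {n} → Point F n → Point F n → Point F n
  _⊞_ = _+ᵛ_ F

  _·_ : ∀ {n} → 𝔽 → Point F n → Point F n
  _·_ = _·ᵛ_ F

  𝟎 : ∀ {n} → Point F n
  𝟎 = 0ᵛ F

  ⊟_ : ∀ {n} → Point F n → Point F n
  ⊟_ = Vec.map ⊝_

  lc : ∀ {n k} → Vec 𝔽 k → Vec (Point F n) k → Point F n
  lc = linearCombination F

  Independent : ∀ {n k} → Vec (Point F n) k → Set
  Independent = LinearlyIndependent F

  pointGroup : ℕ → AbelianGroup 0ℓ 0ℓ
  pointGroup n = record
    { Carrier = Point F n
    ; _∙_     = _⊞_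
    ; ε       = 𝟎
    ; _⁻¹     = ⊟_
    ; isAbelianGroup = record
      { isGroup = record
        { isMonoid = record
          { isSemigroup = record
            { isMagma = record { isEquivalence = isEquivalence ; ∙-cong = cong₂ _⊞_ }
            ; assoc   = Vec.zipWith-assoc 𝔽.+-assoc }
          ; identity = Vec.zipWith-identityˡ 𝔽.+-identityˡ , Vec.zipWith-identityʳ 𝔽.+-identityʳ }
        ; inverse = Vec.zipWith-inverseˡ 𝔽.-‿inverseˡ , Vec.zipWith-inverseʳ 𝔽.-‿inverseʳ
        ; ⁻¹-cong = cong ⊟_ }
      ; comm = Vec.zipWith-comm 𝔽.+-comm } }

  module _ {n : ℕ} where
    open AbelianGroup (pointGroup n) public using () renaming
      (assoc to ⊞-assoc; comm to ⊞-comm; identityˡ to ⊞-identityˡ; identityʳ to ⊞-identityʳ;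
       inverseˡ to ⊟-inverseˡ; inverseʳ to ⊟-inverseʳ)
    open GroupProperties (AbelianGroup.group (pointGroup n)) public using () renaming
      (inverseˡ-unique to ⊟-uniqueˡ; inverseʳ-unique to ⊟-uniqueʳ; x∙y⁻¹≈ε⇒x≈y to u-v≡0⇒u≡v;
       ∙-cancelˡ to ⊞-cancelˡ; ∙-cancelʳ to ⊞-cancelʳ)

  ⊞-interchange : ∀ {n} (u v w x : Point F n) → (u ⊞ v) ⊞ (w ⊞ x) ≡ (u ⊞ w) ⊞ (v ⊞ x)
  ⊞-interchange {n} u v w x = begin
    (u ⊞ v) ⊞ (w ⊞ x)  ≡⟨ ⊞-assoc u v _ ⟩
    u ⊞ (v ⊞ (w ⊞ x))  ≡⟨ cong (u ⊞_) (⊞-assoc v w x) ⟨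
    u ⊞ ((v ⊞ w) ⊞ x)  ≡⟨ cong (λ y → u ⊞ (y ⊞ x)) (⊞-comm v w) ⟩
    u ⊞ ((w ⊞ v) ⊞ x)  ≡⟨ cong (u ⊞_) (⊞-assoc w v x) ⟩
    u ⊞ (w ⊞ (v ⊞ x))  ≡⟨ ⊞-assoc u w _ ⟨
    (u ⊞ w) ⊞ (v ⊞ x)  ∎
    where open ≡-Reasoning

  [u-v]+v≡u : ∀ {n} (u v : Point F n) → (u ⊞ ⊟ v) ⊞ v ≡ u
  [u-v]+v≡u u v = trans (⊞-assoc u (⊟ v) v) (trans (cong (u ⊞_) (⊟-inverseˡ v)) (⊞-identityʳ u))

  [u+v]-v≡u : ∀ {n} (u v : Point F n) → (u ⊞ v) ⊞ ⊟ v ≡ u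
  [u+v]-v≡u u v = trans (⊞-assoc u v (⊟ v)) (trans (cong (u ⊞_) (⊟-inverseʳ v)) (⊞-identityʳ u))

  v+[u-v]≡u : ∀ {n} (u v : Point F n) → v ⊞ (u ⊞ ⊟ v) ≡ u
  v+[u-v]≡u u v = trans (⊞-comm v _) ([u-v]+v≡u u v)

  ·-distribˡ : ∀ {n} c (u v : Point F n) → c · (u ⊞ v) ≡ c · u ⊞ c · v
  ·-distribˡ c []       []       = refl
  ·-distribˡ c (x ∷ u) (y ∷ v) = cong₂ _∷_ (𝔽.distribˡ c x y) (·-distribˡ c u v)

  ·-distribʳ : ∀ {n} c d (v : Point F n) → (c ⊕ d) · v ≡ c · v ⊞ d · v
  ·-distribʳ c d []      = refl
  ·-distribʳ c d (x ∷ v) = cong₂ _∷_ (𝔽.distribʳ x c d) (·-distribʳ c d v)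

  ·-assoc : ∀ {n} c d (v : Point F n) → (c ⊗ d) · v ≡ c · (d · v)
  ·-assoc c d []      = refl
  ·-assoc c d (x ∷ v) = cong₂ _∷_ (𝔽.*-assoc c d x) (·-assoc c d v)

  ·-identity : ∀ {n} (v : Point F n) → 1# · v ≡ v
  ·-identity []      = refl
  ·-identity (x ∷ v) = cong₂ _∷_ (𝔽.*-identityˡ x) (·-identity v)

  ·-zeroˡ : ∀ {n} (v : Point F n) → 0# · v ≡ 𝟎
  ·-zeroˡ []      = refl
  ·-zeroˡ (x ∷ v) = cong₂ _∷_ (𝔽.zeroˡ x) (·-zeroˡ v)

  ·-zeroʳ : ∀ {n} c → c · 𝟎 {n} ≡ 𝟎
  ·-zeroʳ {n} c = trans (Vec.map-replicate (c ⊗_) 0# n) (cong (Vec.replicate n) (𝔽.zeroʳ c))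

  lc-⊞ : ∀ {n k} (c d : Vec 𝔽 k) (vs : Vec (Point F n) k) → lc (c ⊞ d) vs ≡ lc c vs ⊞ lc d vs
  lc-⊞ []       []       []       = sym (⊞-identityˡ 𝟎)
  lc-⊞ (c ∷ cs) (d ∷ ds) (v ∷ vs) = begin
    (c ⊕ d) · v ⊞ lc (cs ⊞ ds) vs            ≡⟨ cong₂ _⊞_ (·-distribʳ c d v) (lc-⊞ cs ds vs) ⟩
    (c · v ⊞ d · v) ⊞ (lc cs vs ⊞ lc ds vs)  ≡⟨ ⊞-interchange _ _ _ _ ⟩
    (c · v ⊞ lc cs vs) ⊞ (d · v ⊞ lc ds vs)  ∎
    where open ≡-Reasoning

  lc-· : ∀ {n k} a (c : Vec 𝔽 k) (vs : Vec (Point F n) k) → lc (a · c) vs ≡ a · lc c vs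
  lc-· a []       []       = sym (·-zeroʳ a)
  lc-· a (c ∷ cs) (v ∷ vs) = begin
    (a ⊗ c) · v ⊞ lc (a · cs) vs  ≡⟨ cong₂ _⊞_ (·-assoc a c v) (lc-· a cs vs) ⟩
    a · (c · v) ⊞ a · lc cs vs    ≡⟨ ·-distribˡ a _ _ ⟨
    a · (c · v ⊞ lc cs vs)        ∎
    where open ≡-Reasoning

  lc-𝟎 : ∀ {n k} (vs : Vec (Point F n) k) → lc 𝟎 vs ≡ 𝟎
  lc-𝟎 []       = refl
  lc-𝟎 (v ∷ vs) = trans (cong₂ _⊞_ (·-zeroˡ v) (lc-𝟎 vs)) (⊞-identityˡ 𝟎)

  lc-⊟ : ∀ {n k} (c : Vec 𝔽 k) (vs : Vec (Point F n) k) → lc c vs ⊞ lc (⊟ c) vs ≡ 𝟎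
  lc-⊟ c vs = trans (sym (lc-⊞ c (⊟ c) vs)) (trans (cong (λ d → lc d vs) (⊟-inverseʳ c)) (lc-𝟎 vs))

  -- Combinations of combinations: the rows ms of a matrix, combined with the
  -- coefficients c, give the coefficients of the result with respect to vs.

  lc-map-lc : ∀ {n k j} (c : Vec 𝔽 j) (ms : Vec (Vec 𝔽 k) j) (vs : Vec (Point F n) k) →
              lc c (Vec.map (λ m → lc m vs) ms) ≡ lc (lc c ms) vs
  lc-map-lc []       []       vs = sym (lc-𝟎 vs)
  lc-map-lc (c ∷ cs) (m ∷ ms) vs = begin
    c · lc m vs ⊞ lc cs (Vec.map (λ m → lc m vs) ms)  ≡⟨ cong₂ _⊞_ (sym (lc-· c m vs)) (lc-map-lc cs ms vs) ⟩
    lc (c · m) vs ⊞ lc (lc cs ms) vs                  ≡⟨ lc-⊞ (c · m) (lc cs ms) vs ⟨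
    lc (c · m ⊞ lc cs ms) vs                          ∎
    where open ≡-Reasoning

  lc-∷ʳ : ∀ {n k} (cs : Vec 𝔽 k) c (vs : Vec (Point F n) k) v →
          lc (cs Vec.∷ʳ c) (vs Vec.∷ʳ v) ≡ lc (c ∷ cs) (v ∷ vs)
  lc-∷ʳ []       c []       v = refl
  lc-∷ʳ (d ∷ cs) c (u ∷ vs) v = begin
    d · u ⊞ lc (cs Vec.∷ʳ c) (vs Vec.∷ʳ v)  ≡⟨ cong (d · u ⊞_) (lc-∷ʳ cs c vs v) ⟩
    d · u ⊞ (c · v ⊞ lc cs vs)              ≡⟨ ⊞-assoc (d · u) (c · v) _ ⟨
    (d · u ⊞ c · v) ⊞ lc cs vs              ≡⟨ cong (_⊞ lc cs vs) (⊞-comm (d · u) (c · v)) ⟩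
    (c · v ⊞ d · u) ⊞ lc cs vs              ≡⟨ ⊞-assoc (c · v) (d · u) _ ⟩
    c · v ⊞ (d · u ⊞ lc cs vs)              ∎
    where open ≡-Reasoning

  lc-injective : ∀ {n k} {vs : Vec (Point F n) k} → Independent vs →
                 ∀ {c d} → lc c vs ≡ lc d vs → c ≡ d
  lc-injective {vs = vs} ind {c} {d} eq = u-v≡0⇒u≡v c d (ind _ (begin
    lc (c ⊞ ⊟ d) vs        ≡⟨ lc-⊞ c (⊟ d) vs ⟩
    lc c vs ⊞ lc (⊟ d) vs  ≡⟨ cong (_⊞ lc (⊟ d) vs) eq ⟩
    lc d vs ⊞ lc (⊟ d) vs  ≡⟨ lc-⊟ d vs ⟩
    𝟎                      ∎))
    where open ≡-Reasoning

  independent-[] : ∀ {n} → Independent {n} []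
  independent-[] [] _ = refl

  independent-tail : ∀ {n k v} {vs : Vec (Point F n) k} → Independent (v ∷ vs) → Independent vs
  independent-tail {v = v} {vs} ind cs eq = Vec.∷-injectiveʳ (ind (0# ∷ cs)
    (trans (cong₂ _⊞_ (·-zeroˡ v) eq) (⊞-identityˡ 𝟎)))

  independent-head : ∀ {n k v} {vs : Vec (Point F n) k} → Independent (v ∷ vs) → ∀ c → lc c vs ≢ v
  independent-head {v = v} {vs} ind c eq = 0#≢1# (sym (Vec.∷-injectiveˡ (ind (1# ∷ ⊟ c) (begin
    1# · v ⊞ lc (⊟ c) vs   ≡⟨ cong (_⊞ lc (⊟ c) vs) (trans (·-identity v) (sym eq)) ⟩
    lc c vs ⊞ lc (⊟ c) vs  ≡⟨ lc-⊟ c vs ⟩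
    𝟎                      ∎))))
    where open ≡-Reasoning

  finite𝔽 : Finite 𝔽
  finite𝔽 = ↔Fin⇒Finite enumeration

  finiteVec : ∀ k → Finite (Vec 𝔽 k)
  finiteVec = vecFinite finite𝔽

  open Finite

  independent-∷ : ∀ {n k v} {vs : Vec (Point F n) k} → Independent vs →
                  (∀ c → lc c vs ≢ v) → Independent (v ∷ vs)
  independent-∷ {v = v} {vs} ind v∉ (c ∷ cs) eq with (finite𝔽 ≡? c) 0#
  ... | yes refl = cong (0# ∷_) (ind cs
    (trans (sym (⊞-identityˡ _)) (trans (cong (_⊞ lc cs vs) (sym (·-zeroˡ v))) eq)))
  -- If c is nonzero, the relation can be solved for v.
  ... | no c≢0 = let y , cy≡1 = inverse c c≢0 in contradiction
    (begin
      lc (y · (⊟ cs)) vs  ≡⟨ lc-· y (⊟ cs) vs ⟩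
      y · lc (⊟ cs) vs    ≡⟨ cong (y ·_) (⊟-uniqueʳ _ _ (lc-⊟ cs vs)) ⟩
      y · (⊟ lc cs vs)    ≡⟨ cong (y ·_) (⊟-uniqueˡ _ _ eq) ⟨
      y · (c · v)         ≡⟨ ·-assoc y c v ⟨
      (y ⊗ c) · v         ≡⟨ cong (_· v) (trans (𝔽.*-comm y c) cy≡1) ⟩
      1# · v              ≡⟨ ·-identity v ⟩
      v                   ∎)
    (v∉ (y · (⊟ cs)))
    where open ≡-Reasoning

  ∷ʳ≡𝟎 : ∀ {k} (cs : Vec 𝔽 k) {c} → cs Vec.∷ʳ c ≡ 𝟎 → c ∷ cs ≡ 𝟎
  ∷ʳ≡𝟎 []       eq = eq
  ∷ʳ≡𝟎 (d ∷ cs) eq with ∷ʳ≡𝟎 cs (Vec.∷-injectiveʳ eq)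
  ... | refl = cong (λ d → 0# ∷ d ∷ 𝟎) (Vec.∷-injectiveˡ eq)

  independent-∷ʳ⁻ : ∀ {n k} (vs : Vec (Point F n) k) v → Independent (vs Vec.∷ʳ v) → Independent (v ∷ vs)
  independent-∷ʳ⁻ vs v ind (c ∷ cs) eq = ∷ʳ≡𝟎 cs (ind (cs Vec.∷ʳ c) (trans (lc-∷ʳ cs c vs v) eq))

  independent-map-lc : ∀ {n k j} {ms : Vec (Vec 𝔽 k) j} {vs : Vec (Point F n) k} →
    Independent ms → Independent vs → Independent (Vec.map (λ m → lc m vs) ms)
  independent-map-lc {ms = ms} {vs} ind-ms ind-vs cs eq =
    ind-ms cs (ind-vs (lc cs ms) (trans (sym (lc-map-lc cs ms vs)) eq))

  independent? : ∀ {n k} (vs : Vec (Point F n) k) → Dec (Independent vs)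
  independent? {n} {k} vs = map′
    (λ all c → All.lookup all (complete (finiteVec k) c)) (λ ind → All.tabulate (λ {c} _ → ind c))
    (All.all? (λ c → (finiteVec n ≡? lc c vs) 𝟎 →-dec (finiteVec k ≡? c) 𝟎) (elements (finiteVec k)))

-- Counting independent tuples: the enumeration

module Counting {q : ℕ} (F : FiniteField q) (n : ℕ) where

  open LinearAlgebra F
  open FiniteField F using () renaming (Carrier to 𝔽)
  open Finite

  points : List (Point F n)
  points = elements (finiteVec n)

  coefficients : ∀ k → List (Vec 𝔽 k)
  coefficients k = elements (finiteVec k)

  finiteTuples : ∀ k → Finite (Vec (Point F n) k)
  finiteTuples k = vecFinite (finiteVec n) k

  tuples : ∀ k → List (Vec (Point F n) k)
  tuples k = elements (finiteTuples k)

  infix 4 _≟_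

  _≟_ : (u v : Point F n) → Dec (u ≡ v)
  _≟_ = _≡?_ (finiteVec n)

  length-coefficients : ∀ k → length (coefficients k) ≡ q ^ k
  length-coefficients k = trans (card-vec finite𝔽 k)
    (cong (_^ k) (trans (List.length-map _ (allFin q)) (List.length-tabulate {n = q} (λ i → i))))

  -- For every vector x, either x is a combination of vs, in exactly one way, or
  -- x ∷ vs is independent.

  ∑-span+independent : ∀ {k} {vs : Vec (Point F n) k} → Independent vs → ∀ x →
    ∑[ c ∈ coefficients k ] ⟦ lc c vs ≟ x ⟧ + ⟦ independent? (x ∷ vs) ⟧ ≡ 1
  ∑-span+independent {k} {vs} ind x with Any.any? (λ c → lc c vs ≟ x) (coefficients k)
  ... | yes any = let c , eq = Any.satisfied any in cong₂ _+_
    (∑-indicator₁ (finiteVec k) (λ c → lc c vs ≟ x) {c} eq (λ eq′ → lc-injective ind (trans eq′ (sym eq))))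
    (⟦no⟧ (independent? (x ∷ vs)) (λ ind′ → independent-head ind′ c eq))
  ... | no ¬any = cong₂ _+_
    (∑-zero (coefficients k) (λ c → ⟦no⟧ (lc c vs ≟ x) (∉span c)))
    (⟦yes⟧ (independent? (x ∷ vs)) (independent-∷ ind ∉span))
    where
    ∉span : ∀ c → lc c vs ≢ x
    ∉span c eq = ¬any (Any.map (λ { refl → eq }) (complete (finiteVec k) c))

  -- An independent k-tuple spans q^k vectors, and each of the others extends it.

  ∑-independent-∷ : ∀ {k} (vs : Vec (Point F n) k) →
    ∑[ x ∈ points ] ⟦ independent? (x ∷ vs) ⟧ ≡ ⟦ independent? vs ⟧ * (q ^ n ∸ q ^ k)
  ∑-independent-∷ {k} vs with independent? vs
  ... | no ¬ind = ∑-zero points (λ x → ⟦no⟧ (independent? (x ∷ vs)) (¬ind ∘ independent-tail))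
  ... | yes ind = sym (trans (*-identityˡ _) (trans (cong (_∸ q ^ k) (sym total)) (m+n∸m≡n (q ^ k) _)))
    where
    open ≡-Reasoning
    total : q ^ k + ∑[ x ∈ points ] ⟦ independent? (x ∷ vs) ⟧ ≡ q ^ n
    total = begin
      q ^ k + ∑[ x ∈ points ] ⟦ independent? (x ∷ vs) ⟧
        ≡⟨ cong (_+ ∑[ x ∈ points ] ⟦ independent? (x ∷ vs) ⟧) (begin
             q ^ k                    ≡⟨ length-coefficients k ⟨
             length (coefficients k)  ≡⟨ length≡∑1 (coefficients k) ⟩
             ∑[ c ∈ coefficients k ] 1      ≡⟨ ∑-cong (coefficients k) (λ c →
               sym (∑-indicator₁ (finiteVec n) (lc c vs ≟_) refl sym)) ⟩
             ∑[ c ∈ coefficients k ] ∑[ x ∈ points ] ⟦ lc c vs ≟ x ⟧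
                                            ≡⟨ ∑-swap (coefficients k) points _ ⟩
             ∑[ x ∈ points ] ∑[ c ∈ coefficients k ] ⟦ lc c vs ≟ x ⟧  ∎) ⟩
      ∑[ x ∈ points ] ∑[ c ∈ coefficients k ] ⟦ lc c vs ≟ x ⟧ + ∑[ x ∈ points ] ⟦ independent? (x ∷ vs) ⟧
        ≡⟨ ∑-distrib-+ points _ _ ⟨
      ∑[ x ∈ points ] (∑[ c ∈ coefficients k ] ⟦ lc c vs ≟ x ⟧ + ⟦ independent? (x ∷ vs) ⟧)
        ≡⟨ ∑-cong points (∑-span+independent ind) ⟩
      ∑[ x ∈ points ] 1  ≡⟨ length≡∑1 points ⟨
      length points      ≡⟨ length-coefficients n ⟩
      q ^ n              ∎

  ∑-tuples-suc : ∀ k (f : Vec (Point F n) (suc k) → ℕ) →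
    ∑ (tuples (suc k)) f ≡ ∑[ vs ∈ tuples k ] ∑[ x ∈ points ] f (x ∷ vs)
  ∑-tuples-suc k f = trans (∑-cartesianProductWith _∷_ points (tuples k) f) (∑-swap points (tuples k) _)

  #independent : ∀ k → ∑[ vs ∈ tuples k ] ⟦ independent? vs ⟧ ≡ tupleCount q n 0 k
  #independent zero    = cong (_+ 0) (⟦yes⟧ (independent? []) independent-[])
  #independent (suc k) = begin
    _                                                             ≡⟨ ∑-tuples-suc k _ ⟩
    ∑[ vs ∈ tuples k ] ∑[ x ∈ points ] ⟦ independent? (x ∷ vs) ⟧  ≡⟨ ∑-cong (tuples k) ∑-independent-∷ ⟩
    ∑[ vs ∈ tuples k ] (⟦ independent? vs ⟧ * _)                  ≡⟨ ∑-distribʳ-* (tuples k) _ _ ⟩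
    ∑[ vs ∈ tuples k ] ⟦ independent? vs ⟧ * _                    ≡⟨ cong (_* _) (#independent k) ⟩
    tupleCount q n 0 (suc k)                                      ∎
    where open ≡-Reasoning

  -- The tuples that stay independent together with a fixed nonzero vector.  With
  -- w at the far end, the recursion on the tuple is the same as without w.

  #independent-∷ʳ : ∀ {w : Point F n} → w ≢ 𝟎 → ∀ k →
    ∑[ vs ∈ tuples k ] ⟦ independent? (vs Vec.∷ʳ w) ⟧ ≡ tupleCount q n 1 k
  #independent-∷ʳ {w} w≢𝟎 zero    = cong (_+ 0) (⟦yes⟧ (independent? (w ∷ []))
    (independent-∷ independent-[] (λ { [] → w≢𝟎 ∘ sym })))
  #independent-∷ʳ {w} w≢𝟎 (suc k) = begin
    _                                                      ≡⟨ ∑-tuples-suc k _ ⟩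
    _
      ≡⟨ ∑-cong (tuples k) (λ vs → ∑-independent-∷ (vs Vec.∷ʳ w)) ⟩
    _                                                      ≡⟨ ∑-distribʳ-* (tuples k) _ _ ⟩
    ∑[ vs ∈ tuples k ] ⟦ independent? (vs Vec.∷ʳ w) ⟧ * _  ≡⟨ cong (_* _) (#independent-∷ʳ w≢𝟎 k) ⟩
    tupleCount q n 1 (suc k)  ∎
    where open ≡-Reasoning

  independentTuples : ∀ k → List (Vec (Point F n) k)
  independentTuples k = filter independent? (tuples k)

  length-independentTuples : ∀ k → length (independentTuples k) ≡ tupleCount q n 0 k
  length-independentTuples k = begin
    length (independentTuples k)                  ≡⟨ length≡∑1 (independentTuples k) ⟩
    _                                             ≡⟨ ∑-filter independent? (tuples k) _ ⟩
    ∑[ vs ∈ tuples k ] (⟦ independent? vs ⟧ * 1)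
      ≡⟨ ∑-cong (tuples k) (λ vs → *-identityʳ ⟦ independent? vs ⟧) ⟩
    _                                             ≡⟨ #independent k ⟩
    tupleCount q n 0 k  ∎
    where open ≡-Reasoning

  ∈-independentTuples⁻ : ∀ {k} {vs : Vec (Point F n) k} → vs ∈ independentTuples k → Independent vs
  ∈-independentTuples⁻ {k} vs∈ = proj₂ (∈-filter⁻ independent? {xs = tuples k} vs∈)

  ∈-independentTuples⁺ : ∀ {k} {vs : Vec (Point F n) k} → Independent vs → vs ∈ independentTuples k
  ∈-independentTuples⁺ {k} {vs} = ∈-filter⁺ independent? (complete (finiteTuples k) vs)

  unique-independentTuples : ∀ k → Unique≡ (independentTuples k)
  unique-independentTuples k = Unique≡.filter⁺ independent? (unique (finiteTuples k))

  -- How often a given vector lies in the span of an independent k-tuple.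

  module Bases (k : ℕ) (1<q : 1 < q) (k≤n : k ≤ n) where

    bases : List (Vec (Point F n) k)
    bases = independentTuples k

    #bases : ℕ
    #bases = tupleCount q n 0 k

    -- The number of bases whose span contains w.  The inner sum is 0 or 1, as
    -- coefficients with respect to independent vectors are unique.

    spanCount : Point F n → ℕ
    spanCount w = ∑[ vs ∈ bases ] ∑[ c ∈ coefficients k ] ⟦ lc c vs ≟ w ⟧

    spanCount≤#bases : ∀ w → spanCount w ≤ #bases
    spanCount≤#bases w = begin
      spanCount w          ≤⟨ ∑-mono-∈ bases (λ vs∈ → ≤-trans (m≤m+n _ _)
                               (≤-reflexive (∑-span+independent (∈-independentTuples⁻ vs∈) w))) ⟩
      ∑[ _ ∈ bases ] 1  ≡⟨ length≡∑1 bases ⟨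
      length bases      ≡⟨ length-independentTuples k ⟩
      #bases            ∎
      where open ≤-Reasoning

    -- The second summand counts the bases whose span does not contain w.

    spanCount+avoid≤#bases : ∀ {w} → w ≢ 𝟎 → spanCount w + tupleCount q n 1 k ≤ #bases
    spanCount+avoid≤#bases {w} w≢𝟎 = begin
      spanCount w + tupleCount q n 1 k
        ≡⟨ cong (spanCount w +_) (#independent-∷ʳ w≢𝟎 k) ⟨
      spanCount w + ∑[ vs ∈ tuples k ] ⟦ independent? (vs Vec.∷ʳ w) ⟧
        ≤⟨ +-monoʳ-≤ (spanCount w) (∑-mono (tuples k) outside-≤) ⟩
      spanCount w + ∑[ vs ∈ tuples k ] (⟦ independent? vs ⟧ * ⟦ independent? (w ∷ vs) ⟧)
        ≡⟨ cong (spanCount w +_) (∑-filter independent? (tuples k) _) ⟨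
      spanCount w + ∑[ vs ∈ bases ] ⟦ independent? (w ∷ vs) ⟧
        ≡⟨ ∑-distrib-+ bases _ _ ⟨
      ∑[ vs ∈ bases ] (∑[ c ∈ coefficients k ] ⟦ lc c vs ≟ w ⟧ + ⟦ independent? (w ∷ vs) ⟧)
        ≡⟨ ∑-cong-∈ bases (λ vs∈ → ∑-span+independent (∈-independentTuples⁻ vs∈) w) ⟩
      ∑[ _ ∈ bases ] 1  ≡⟨ length≡∑1 bases ⟨
      length bases      ≡⟨ length-independentTuples k ⟩
      #bases            ∎
      where
      open ≤-Reasoning
      outside-≤ : ∀ vs → ⟦ independent? (vs Vec.∷ʳ w) ⟧ ≤ ⟦ independent? vs ⟧ * ⟦ independent? (w ∷ vs) ⟧
      outside-≤ vs with independent? (vs Vec.∷ʳ w)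
      ... | no  _   = z≤n
      ... | yes ind = ≤-reflexive (sym (cong₂ _*_
        (⟦yes⟧ (independent? vs) (independent-tail ind′)) (⟦yes⟧ (independent? (w ∷ vs)) ind′)))
        where ind′ = independent-∷ʳ⁻ vs w ind

    -- At most a fraction q^k / q^n of the bases has a given nonzero vector w in
    -- its span.  Writing Y for spanCount w, G for #bases and C for the number of
    -- independent tuples that can be extended by w, this combines Y ≤ G, Y + C ≤ G
    -- and (q^n - 1) C = (q^n - q^k) G.

    spanCount-bound : ∀ {w} → w ≢ 𝟎 → q ^ n * spanCount w ≤ q ^ k * #bases
    spanCount-bound {w} w≢𝟎 = +-cancelʳ-≤ (#bases * E) _ _ (begin
      q ^ n * Y + #bases * E  ≡⟨ cong₂ (λ x y → x * Y + y) (sym Q≡) (tupleCount-suc q n k) ⟩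
      suc Q′ * Y + Q′ * C     ≡⟨ lemma₁ Q′ Y C ⟩
      Y + Q′ * (Y + C)                   ≤⟨ +-mono-≤ (spanCount≤#bases w)
                                               (*-monoʳ-≤ Q′ (spanCount+avoid≤#bases w≢𝟎)) ⟩
      suc Q′ * #bases                     ≡⟨ cong (_* #bases)
                                               (trans Q≡ (sym (m+[n∸m]≡n (^-monoʳ-≤ q {{q≢0}} k≤n)))) ⟩
      (q ^ k + E) * #bases         ≡⟨ lemma₂ (q ^ k) E #bases ⟩
      q ^ k * #bases + #bases * E  ∎)
      where
      open ≤-Reasoning
      instance
        q≢0 : NonZero q
        q≢0 = >-nonZero (<-trans z<s 1<q)
      E Q′ Y C : ℕ
      E = q ^ n ∸ q ^ k
      Q′ = q ^ n ∸ 1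
      Y = spanCount w
      C = tupleCount q n 1 k
      Q≡ : suc Q′ ≡ q ^ n
      Q≡ = m+[n∸m]≡n (m^n>0 q n)
      lemma₁ : ∀ Q Y C → (1 + Q) * Y + Q * C ≡ Y + Q * (Y + C)
      lemma₁ = solve-∀
      lemma₂ : ∀ a b c → (a + b) * c ≡ a * c + c * b
      lemma₂ = solve-∀

-- Incidences between frames and a point set: the second moment

-- The square of a difference, expanded without subtraction.

∣-∣-square : ∀ m n → ∣ m - n ∣ * ∣ m - n ∣ + 2 * (m * n) ≡ m * m + n * n
∣-∣-square zero    n       = +-identityʳ (n * n)
∣-∣-square (suc m) zero    = cong (λ x → suc m * suc m + 2 * x) (*-zeroʳ m)
∣-∣-square (suc m) (suc n) = begin
  ∣ m - n ∣ * ∣ m - n ∣ + 2 * (suc m * suc n)            ≡⟨ lemma₁ (∣ m - n ∣ * ∣ m - n ∣) m n ⟩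
  ∣ m - n ∣ * ∣ m - n ∣ + 2 * (m * n) + 2 * (m + n + 1)  ≡⟨ cong (_+ 2 * (m + n + 1)) (∣-∣-square m n) ⟩
  m * m + n * n + 2 * (m + n + 1)                        ≡⟨ lemma₂ m n ⟩
  suc m * suc m + suc n * suc n                          ∎
  where
  open ≡-Reasoning
  lemma₁ : ∀ d m n → d + 2 * ((1 + m) * (1 + n)) ≡ d + 2 * (m * n) + 2 * (m + n + 1)
  lemma₁ = solve-∀
  lemma₂ : ∀ m n → m * m + n * n + 2 * (m + n + 1) ≡ (1 + m) * (1 + m) + (1 + n) * (1 + n)
  lemma₂ = solve-∀

module Incidences {q : ℕ} (F : FiniteField q) (n k : ℕ) (1<q : 1 < q) (k≤n : k ≤ n)
                  (S : List (Vec (FiniteField.Carrier F) n)) (S! : Unique≡ S) where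

  open LinearAlgebra F
  open FiniteField F using () renaming (Carrier to 𝔽)
  open Finite
  open Counting F n
  open Bases k 1<q k≤n

  s D Q K : ℕ
  s = length S
  D = q ^ (n ∸ k)
  Q = q ^ n
  K = q ^ k

  K*D≡Q : K * D ≡ Q
  K*D≡Q = trans (sym (^-distribˡ-+-* q k (n ∸ k))) (cong (q ^_) (m+[n∸m]≡n k≤n))

  instance
    K≢0 : NonZero K
    K≢0 = m^n≢0 q k {{>-nonZero (<-trans z<s 1<q)}}

    #bases≢0 : NonZero #bases
    #bases≢0 = tupleCount≢0 1<q k≤n

  cs : List (Vec 𝔽 k)
  cs = coefficients k

  -- A parametrised flat: a tuple vs of directions and a base point a, with points
  -- a + lc c vs.  It parametrises a k-flat bijectively when vs is independent,
  -- which is not part of the type.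

  Frame : Set
  Frame = Vec (Point F n) k × Point F n

  flat : Frame → PointSet F n
  flat (vs , a) x = ∃[ c ] x ≡ a ⊞ lc c vs

  -- The number of points of S on the flat of a frame, counted through parameters:
  -- a point is counted once for each c that yields it, hence once if the tuple is
  -- independent.

  hits : Frame → ℕ
  hits (vs , a) = ∑[ c ∈ cs ] ∑[ p ∈ S ] ⟦ a ⊞ lc c vs ≟ p ⟧

  common-points≤hits : ∀ {A : PointSet F n} {m} fr → (∀ {x} → A x → flat fr x) →
           HasAtLeast (A ∩ (_∈ S)) m → m ≤ hits fr
  common-points≤hits fr@(vs , a) A⊆flat (ys , ys! , refl , ys⊆A∩S) = begin
    length ys                                    ≡⟨ length≡∑1 ys ⟩
    ∑[ _ ∈ ys ] 1
      ≤⟨ ∑-mono-∈ ys (λ y∈ → on-flat (A⊆flat (proj₁ (All.lookup ys⊆A∩S y∈)))) ⟩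
    ∑[ y ∈ ys ] ∑[ c ∈ cs ] ⟦ a ⊞ lc c vs ≟ y ⟧  ≤⟨ ∑-⊆ _ ys! (λ y∈ → proj₂ (All.lookup ys⊆A∩S y∈)) ⟩
    ∑[ y ∈ S ] ∑[ c ∈ cs ] ⟦ a ⊞ lc c vs ≟ y ⟧   ≡⟨ ∑-swap cs S _ ⟨
    hits fr  ∎
    where
    open ≤-Reasoning
    on-flat : ∀ {y} → flat fr y → 1 ≤ ∑[ c ∈ cs ] ⟦ a ⊞ lc c vs ≟ y ⟧
    on-flat {y} (c , y≡) = begin
      1                                    ≡⟨ ⟦yes⟧ (a ⊞ lc c vs ≟ y) (sym y≡) ⟨
      ⟦ a ⊞ lc c vs ≟ y ⟧                  ≡⟨ +-identityʳ _ ⟨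
      ∑[ c ∈ c ∷ [] ] ⟦ a ⊞ lc c vs ≟ y ⟧  ≤⟨ ∑-⊆ _ ([] ∷ []) (λ { (here refl) → complete (finiteVec k) c }) ⟩
      ∑[ c ∈ cs ] ⟦ a ⊞ lc c vs ≟ y ⟧      ∎

  -- First moment: for fixed c and p there is exactly one a with a + lc c vs = p.

  ∑-hits : ∀ vs → ∑[ a ∈ points ] hits (vs , a) ≡ K * s
  ∑-hits vs = begin
    ∑[ a ∈ points ] ∑[ c ∈ cs ] ∑[ p ∈ S ] ⟦ a ⊞ lc c vs ≟ p ⟧  ≡⟨ ∑-swap points cs _ ⟩
    ∑[ c ∈ cs ] ∑[ a ∈ points ] ∑[ p ∈ S ] ⟦ a ⊞ lc c vs ≟ p ⟧  ≡⟨ ∑-cong cs (λ c → trans (∑-swap points S _) (∑-cong S (λ p →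
      -- the solution is a = p - lc c vs
      ∑-indicator₁ (finiteVec n) (λ a → a ⊞ lc c vs ≟ p) {p ⊞ ⊟ lc c vs} ([u-v]+v≡u p (lc c vs))
        (λ {a} eq → trans (sym ([u+v]-v≡u a (lc c vs))) (cong (_⊞ ⊟ lc c vs) eq))))) ⟩
    ∑[ c ∈ cs ] ∑[ p ∈ S ] 1  ≡⟨ ∑-cong cs (λ _ → sym (length≡∑1 S)) ⟩
    ∑[ c ∈ cs ] s             ≡⟨ ∑-const cs s ⟩
    length cs * s             ≡⟨ cong (_* s) (length-coefficients k) ⟩
    K * s                     ∎
    where open ≡-Reasoning

  lc-shift : ∀ (vs : Vec (Point F n) k) a c d → (a ⊞ ⊟ lc c vs) ⊞ lc d vs ≡ a ⊞ lc (d ⊞ ⊟ c) vs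
  lc-shift vs a c d = begin
    (a ⊞ ⊟ lc c vs) ⊞ lc d vs    ≡⟨ ⊞-assoc a _ _ ⟩
    a ⊞ (⊟ lc c vs ⊞ lc d vs)    ≡⟨ cong (a ⊞_) (⊞-comm _ _) ⟩
    a ⊞ (lc d vs ⊞ ⊟ lc c vs)    ≡⟨ cong (λ x → a ⊞ (lc d vs ⊞ x)) (⊟-uniqueʳ _ _ (lc-⊟ c vs)) ⟨
    a ⊞ (lc d vs ⊞ lc (⊟ c) vs)  ≡⟨ cong (a ⊞_) (lc-⊞ d (⊟ c) vs) ⟨
    a ⊞ lc (d ⊞ ⊟ c) vs          ∎
    where open ≡-Reasoning

  -- The hits depend only on the flat, so moving the base point within it does not
  -- change them; one inequality suffices below.

  hits-shift : ∀ vs a c → hits (vs , a ⊞ ⊟ lc c vs) ≤ hits (vs , a)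
  hits-shift vs a c = begin
    hits (vs , a ⊞ ⊟ lc c vs)                                     ≡⟨ ∑-cong cs (λ d → ∑-cong S (λ p →
                                                                       cong (λ x → ⟦ x ≟ p ⟧) (lc-shift vs a c d))) ⟩
    ∑[ d ∈ cs ] ∑[ p ∈ S ] ⟦ a ⊞ lc (d ⊞ ⊟ c) vs ≟ p ⟧            ≤⟨ ∑-reindex-≤ (finiteVec k) (_⊞ ⊟ c)
                                                                       (λ {x} {y} → ⊞-cancelʳ (⊟ c) x y) _ ⟩
    hits (vs , a)  ∎
    where open ≤-Reasoning

  -- Second moment: expanding one factor as a sum over c and p determines a, which
  -- is a point on the flat through p in the direction of vs.

  ∑-hits² : ∀ vs → ∑[ a ∈ points ] (hits (vs , a) * hits (vs , a)) ≤ K * ∑[ p ∈ S ] hits (vs , p)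
  ∑-hits² vs = begin
    ∑[ a ∈ points ] (h a * h a)
      ≡⟨ ∑-cong points (λ a → begin-equality
           h a * h a                                             ≡⟨ ∑-distribʳ-* cs (h a) _ ⟨
           ∑[ c ∈ cs ] ((∑[ p ∈ S ] ⟦ a ⊞ lc c vs ≟ p ⟧) * h a)
             ≡⟨ ∑-cong cs (λ c → sym (∑-distribʳ-* S (h a) _)) ⟩
           ∑[ c ∈ cs ] ∑[ p ∈ S ] (⟦ a ⊞ lc c vs ≟ p ⟧ * h a)  ∎) ⟩
    ∑[ a ∈ points ] ∑[ c ∈ cs ] ∑[ p ∈ S ] (⟦ a ⊞ lc c vs ≟ p ⟧ * h a)  ≡⟨ ∑-swap points cs _ ⟩
    ∑[ c ∈ cs ] ∑[ a ∈ points ] ∑[ p ∈ S ] (⟦ a ⊞ lc c vs ≟ p ⟧ * h a)      ≡⟨ ∑-cong cs (λ c → trans (∑-swap points S _) (∑-cong S (λ p →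
      ∑-indicator (finiteVec n) (λ a → a ⊞ lc c vs ≟ p) h {p ⊞ ⊟ lc c vs} ([u-v]+v≡u p (lc c vs))
        (λ {a} eq → trans (sym ([u+v]-v≡u a (lc c vs))) (cong (_⊞ ⊟ lc c vs) eq))))) ⟩
    ∑[ c ∈ cs ] ∑[ p ∈ S ] h (p ⊞ ⊟ lc c vs)  ≤⟨ ∑-mono cs (λ c → ∑-mono S (λ p → hits-shift vs p c)) ⟩
    ∑[ c ∈ cs ] ∑[ p ∈ S ] h p                ≡⟨ ∑-const cs _ ⟩
    length cs * ∑[ p ∈ S ] h p                ≡⟨ cong (_* ∑ S h) (length-coefficients k) ⟩
    K * ∑[ p ∈ S ] h p                        ∎
    where
    open ≤-Reasoning
    h : Point F n → ℕ
    h a = hits (vs , a)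

  -- The left sum counts triples (vs, p, p′) with p′ - p in the span of vs.  Pairs
  -- with p = p′ contribute #bases each, all others at most #bases / D.

  ∑-bases-hits : D * ∑[ vs ∈ bases ] ∑[ p ∈ S ] hits (vs , p) ≤ s * (D * #bases + s * #bases)
  ∑-bases-hits = begin
    D * ∑[ vs ∈ bases ] ∑[ p ∈ S ] hits (vs , p)
      ≡⟨ cong (D *_) (trans (∑-swap bases S _) (∑-cong S (λ p →
          trans (∑-cong bases (λ vs → ∑-swap cs S _)) (trans (∑-swap bases S _)
          (∑-cong S (λ p′ → ∑-cong bases (λ vs → ∑-cong cs (λ c →
            ⟦⟧-cong (p ⊞ lc c vs ≟ p′) (lc c vs ≟ p′ ⊞ ⊟ p)
              (λ eq → trans (sym ([u+v]-v≡u (lc c vs) p)) (cong (_⊞ ⊟ p) (trans (⊞-comm (lc c vs) p) eq)))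
              (λ eq → trans (cong (p ⊞_) eq) (v+[u-v]≡u p′ p)))))))))) ⟩
    D * ∑[ p ∈ S ] ∑[ p′ ∈ S ] spanCount (p′ ⊞ ⊟ p)
      ≡⟨ trans (sym (∑-distribˡ-* S D _)) (∑-cong S (λ p → sym (∑-distribˡ-* S D _))) ⟩
    ∑[ p ∈ S ] ∑[ p′ ∈ S ] (D * spanCount (p′ ⊞ ⊟ p))
      ≤⟨ ∑-mono S (λ p → ∑-mono S (bound p)) ⟩
    ∑[ p ∈ S ] ∑[ p′ ∈ S ] (⟦ p ≟ p′ ⟧ * (D * #bases) + #bases)
      ≤⟨ ∑-mono S (λ p → begin
           ∑[ p′ ∈ S ] (⟦ p ≟ p′ ⟧ * (D * #bases) + #bases)              ≡⟨ ∑-distrib-+ S _ _ ⟩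
           ∑[ p′ ∈ S ] (⟦ p ≟ p′ ⟧ * (D * #bases)) + ∑[ p′ ∈ S ] #bases
             ≡⟨ cong (∑[ p′ ∈ S ] (⟦ p ≟ p′ ⟧ * (D * #bases)) +_) (∑-const S _) ⟩
           ∑[ p′ ∈ S ] (⟦ p ≟ p′ ⟧ * (D * #bases)) + s * #bases
             ≤⟨ +-monoˡ-≤ _ (∑-⊆ _ S! (λ _ → complete (finiteVec n) _)) ⟩
           ∑[ p′ ∈ points ] (⟦ p ≟ p′ ⟧ * (D * #bases)) + s * #bases
             ≡⟨ cong (_+ _) (∑-indicator (finiteVec n) (p ≟_) (λ _ → D * #bases) {p} refl sym) ⟩
           D * #bases + s * #bases  ∎) ⟩
    ∑[ p ∈ S ] (D * #bases + s * #bases)  ≡⟨ ∑-const S _ ⟩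
    s * (D * #bases + s * #bases)         ∎
    where
    open ≤-Reasoning
    D*span≤ : ∀ {w} → w ≢ 𝟎 → D * spanCount w ≤ #bases
    D*span≤ {w} w≢𝟎 = *-cancelˡ-≤ K (begin
      K * (D * spanCount w)  ≡⟨ *-assoc K D _ ⟨
      K * D * spanCount w    ≡⟨ cong (_* spanCount w) K*D≡Q ⟩
      Q * spanCount w        ≤⟨ spanCount-bound w≢𝟎 ⟩
      K * #bases             ∎)
    bound : ∀ p p′ → D * spanCount (p′ ⊞ ⊟ p) ≤ ⟦ p ≟ p′ ⟧ * (D * #bases) + #bases
    bound p p′ with p ≟ p′
    ... | yes _   = begin
      D * spanCount (p′ ⊞ ⊟ p)   ≤⟨ *-monoʳ-≤ D (spanCount≤#bases (p′ ⊞ ⊟ p)) ⟩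
      D * #bases                 ≡⟨ *-identityˡ _ ⟨
      1 * (D * #bases)           ≤⟨ m≤m+n _ _ ⟩
      1 * (D * #bases) + #bases  ∎
    ... | no p≢p′ = D*span≤ (λ eq → p≢p′ (sym (u-v≡0⇒u≡v p′ p eq)))

  -- All frames with independent directions.

  frames : List Frame
  frames = cartesianProductWith _,_ bases points

  -- The mean of hits over all base points is s / D; scaled by D to stay integral.

  deviation² : Frame → ℕ
  deviation² fr = ∣ D * hits fr - s ∣ * ∣ D * hits fr - s ∣

  ∑-frames : ∀ (f : Frame → ℕ) → ∑ frames f ≡ ∑[ vs ∈ bases ] ∑[ a ∈ points ] f (vs , a)
  ∑-frames = ∑-cartesianProductWith _,_ bases points

  ∑-frames-hits : ∑ frames hits ≡ #bases * (K * s)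
  ∑-frames-hits = begin
    ∑ frames hits                                  ≡⟨ ∑-frames hits ⟩
    ∑[ vs ∈ bases ] ∑[ a ∈ points ] hits (vs , a)  ≡⟨ ∑-cong bases ∑-hits ⟩
    ∑[ vs ∈ bases ] (K * s)                        ≡⟨ ∑-const bases _ ⟩
    length bases * (K * s)                         ≡⟨ cong (_* (K * s)) (length-independentTuples k) ⟩
    #bases * (K * s)                               ∎
    where open ≡-Reasoning

  ∑-frames-hits² : D * ∑[ fr ∈ frames ] (hits fr * hits fr) ≤ K * (s * (D * #bases + s * #bases))
  ∑-frames-hits² = begin
    D * ∑[ fr ∈ frames ] (hits fr * hits fr)  ≡⟨ cong (D *_) (∑-frames _) ⟩
    D * ∑[ vs ∈ bases ] ∑[ a ∈ points ] (hits (vs , a) * hits (vs , a))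
      ≤⟨ *-monoʳ-≤ D (∑-mono bases ∑-hits²) ⟩
    D * ∑[ vs ∈ bases ] (K * ∑[ p ∈ S ] hits (vs , p))  ≡⟨ cong (D *_) (∑-distribˡ-* bases K _) ⟩
    D * (K * P)                                         ≡⟨ lemma D K P ⟩
    K * (D * P)                                         ≤⟨ *-monoʳ-≤ K ∑-bases-hits ⟩
    K * (s * (D * #bases + s * #bases))                 ∎
    where
    open ≤-Reasoning
    P : ℕ
    P = ∑[ vs ∈ bases ] ∑[ p ∈ S ] hits (vs , p)
    lemma : ∀ a b c → a * (b * c) ≡ b * (a * c)
    lemma = solve-∀

  length-frames : length frames ≡ #bases * (K * D)
  length-frames = trans (length-cartesianProductWith _,_ bases points)
    (cong₂ _*_ (length-independentTuples k) (trans (length-coefficients n) (sym K*D≡Q)))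

  -- Expand the square; the cross term, moved to the left, is known exactly, and
  -- the s²-terms cancel.

  ∑-deviation²-bound : ∑ frames deviation² ≤ K * #bases * (D * D * s)
  ∑-deviation²-bound = +-cancelʳ-≤ (2 * (#bases * (K * D) * (s * s))) _ _ (begin
    ∑ frames deviation² + 2 * (#bases * (K * D) * (s * s))
      ≡⟨ cong (∑ frames deviation² +_) (begin-equality
           2 * (#bases * (K * D) * (s * s))        ≡⟨ lemma₁ D K #bases s ⟩
           2 * D * s * (#bases * (K * s))          ≡⟨ cong (2 * D * s *_) ∑-frames-hits ⟨
           2 * D * s * ∑ frames hits               ≡⟨ ∑-distribˡ-* frames (2 * D * s) hits ⟨
           ∑[ fr ∈ frames ] (2 * D * s * hits fr)  ∎) ⟩
    ∑ frames deviation² + ∑[ fr ∈ frames ] (2 * D * s * hits fr)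
      ≡⟨ ∑-distrib-+ frames _ _ ⟨
    ∑[ fr ∈ frames ] (deviation² fr + 2 * D * s * hits fr)
      ≡⟨ ∑-cong frames (λ fr → trans (cong (deviation² fr +_) (lemma₂ D s (hits fr)))
           (trans (∣-∣-square (D * hits fr) s) (cong (_+ s * s) (lemma₃ D (hits fr))))) ⟩
    ∑[ fr ∈ frames ] (D * D * (hits fr * hits fr) + s * s)
      ≡⟨ ∑-distrib-+ frames _ _ ⟩
    ∑[ fr ∈ frames ] (D * D * (hits fr * hits fr)) + ∑[ _ ∈ frames ] (s * s)
      ≡⟨ cong₂ _+_ (trans (∑-distribˡ-* frames (D * D) _) (*-assoc D D _))
           (trans (∑-const frames (s * s)) (cong (_* (s * s)) length-frames)) ⟩
    D * (D * ∑[ fr ∈ frames ] (hits fr * hits fr)) + #bases * (K * D) * (s * s)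
      ≤⟨ +-monoˡ-≤ _ (*-monoʳ-≤ D ∑-frames-hits²) ⟩
    D * (K * (s * (D * #bases + s * #bases))) + #bases * (K * D) * (s * s)
      ≡⟨ lemma₄ D K #bases s ⟩
    K * #bases * (D * D * s) + 2 * (#bases * (K * D) * (s * s))  ∎)
    where
    open ≤-Reasoning
    lemma₁ : ∀ d k g s → 2 * (g * (k * d) * (s * s)) ≡ 2 * d * s * (g * (k * s))
    lemma₁ = solve-∀
    lemma₂ : ∀ d s h → 2 * d * s * h ≡ 2 * (d * h * s)
    lemma₂ = solve-∀
    lemma₃ : ∀ d h → d * h * (d * h) ≡ d * d * (h * h)
    lemma₃ = solve-∀
    lemma₄ : ∀ d k g s → d * (k * (s * (d * g + s * g))) + g * (k * d) * (s * s) ≡ k * g * (d * d * s) + 2 * (g * (k * d) * (s * s))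
    lemma₄ = solve-∀

  -- The truncated difference makes the claim trivial for D * m ≤ s.

  deviation-bound : ∀ {m} (R : List Frame) → Unique≡ R →
    All (λ fr → Independent (proj₁ fr) × m ≤ hits fr) R → K * #bases ≤ length R →
    (D * m ∸ s) * (D * m ∸ s) ≤ D * D * s
  deviation-bound {m} R R! good many = *-cancelˡ-≤ (K * #bases) {{m*n≢0 K #bases}} (begin
    K * #bases * (e * e)  ≤⟨ *-monoˡ-≤ (e * e) many ⟩
    length R * (e * e)    ≡⟨ ∑-const R (e * e) ⟨
    ∑[ _ ∈ R ] (e * e)
      ≤⟨ ∑-mono-∈ R (λ fr∈ → let h = deviates (proj₂ (All.lookup good fr∈)) in *-mono-≤ h h) ⟩
    ∑ R deviation²             ≤⟨ ∑-⊆ deviation² R! (λ fr∈ → ∈-cartesianProductWith⁺ _,_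
                                    (∈-independentTuples⁺ (proj₁ (All.lookup good fr∈))) (complete (finiteVec n) _)) ⟩
    ∑ frames deviation²       ≤⟨ ∑-deviation²-bound ⟩
    K * #bases * (D * D * s)  ∎)
    where
    open ≤-Reasoning
    e : ℕ
    e = D * m ∸ s
    deviates : ∀ {fr} → m ≤ hits fr → e ≤ ∣ D * hits fr - s ∣
    deviates m≤h = ≤-trans (∸-monoˡ-≤ s (*-monoʳ-≤ D m≤h)) (m∸n≤∣m-n∣ _ s)

-- From the natural-number inequality to the real bound

ι : ℕ → ℚ
ι n = ℤ.+ n / 1

toℚᵘ-ι : ∀ n → toℚᵘ (ι n) ℚᵘ.≃ mkℚᵘ (ℤ.+ n) 0
toℚᵘ-ι n = ℚ.toℚᵘ-fromℚᵘ (mkℚᵘ (ℤ.+ n) 0)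

ι-* : ∀ m n → ι m *ℚ ι n ≡ ι (m * n)
ι-* m n = ℚ.toℚᵘ-injective (begin-equality
  toℚᵘ (ι m *ℚ ι n)           ≃⟨ ℚ.toℚᵘ-homo-* (ι m) (ι n) ⟩
  toℚᵘ (ι m) ℚᵘ.* toℚᵘ (ι n)  ≃⟨ ℚᵘ.*-cong (toℚᵘ-ι m) (toℚᵘ-ι n) ⟩
  mkℚᵘ (ℤ.+ m ℤ.* ℤ.+ n) 0    ≡⟨ cong (λ i → mkℚᵘ i 0) (ℤ.pos-* m n) ⟨
  mkℚᵘ (ℤ.+ (m * n)) 0        ≃⟨ toℚᵘ-ι (m * n) ⟨
  toℚᵘ (ι (m * n))            ∎)
  where open ℚᵘ.≤-Reasoning

ι-+ : ∀ m n → ι m +ℚ ι n ≡ ι (m + n)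
ι-+ m n = ℚ.toℚᵘ-injective (begin-equality
  toℚᵘ (ι m +ℚ ι n)                           ≃⟨ ℚ.toℚᵘ-homo-+ (ι m) (ι n) ⟩
  toℚᵘ (ι m) ℚᵘ.+ toℚᵘ (ι n)                  ≃⟨ ℚᵘ.+-cong (toℚᵘ-ι m) (toℚᵘ-ι n) ⟩
  mkℚᵘ (ℤ.+ m ℤ.* ℤ.1ℤ ℤ.+ ℤ.+ n ℤ.* ℤ.1ℤ) 0
    ≡⟨ cong₂ (λ i j → mkℚᵘ (i ℤ.+ j) 0) (ℤ.*-identityʳ (ℤ.+ m)) (ℤ.*-identityʳ (ℤ.+ n)) ⟩
  mkℚᵘ (ℤ.+ (m + n)) 0                        ≃⟨ toℚᵘ-ι (m + n) ⟨
  toℚᵘ (ι (m + n))  ∎)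
  where open ℚᵘ.≤-Reasoning

ι-cancel-< : ∀ {m n} → ι m <ℚ ι n → m < n
ι-cancel-< {m} {n} m<n = ℤ.drop‿+<+ (subst₂ ℤ._<_ (ℤ.*-identityʳ _) (ℤ.*-identityʳ _) (ℚᵘ.drop-*<* (begin-strict
  mkℚᵘ (ℤ.+ m) 0  ≃⟨ toℚᵘ-ι m ⟨
  toℚᵘ (ι m)      <⟨ ℚ.toℚᵘ-mono-< m<n ⟩
  toℚᵘ (ι n)      ≃⟨ toℚᵘ-ι n ⟩
  mkℚᵘ (ℤ.+ n) 0  ∎)))
  where open ℚᵘ.≤-Reasoning

1/n*n≡1 : ∀ m .{{_ : NonZero m}} → (ℤ.+ 1 / m) *ℚ ι m ≡ 1ℚ
1/n*n≡1 (suc m) = ℚ.toℚᵘ-injective (begin-equality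
  toℚᵘ ((ℤ.+ 1 / suc m) *ℚ ι (suc m))         ≃⟨ ℚ.toℚᵘ-homo-* (ℤ.+ 1 / suc m) (ι (suc m)) ⟩
  toℚᵘ (ℤ.+ 1 / suc m) ℚᵘ.* toℚᵘ (ι (suc m))  ≃⟨ ℚᵘ.*-cong (ℚ.toℚᵘ-fromℚᵘ (mkℚᵘ (ℤ.+ 1) m)) (toℚᵘ-ι (suc m)) ⟩
  mkℚᵘ (ℤ.+ 1) m ℚᵘ.* mkℚᵘ (ℤ.+ suc m) 0      ≃⟨ ℚᵘ.*-inverseˡ (mkℚᵘ (ℤ.+ suc m) 0) ⟩
  toℚᵘ 1ℚ                                     ∎)
  where open ℚᵘ.≤-Reasoning

square-< : ∀ {a b} → 0ℚ ≤ℚ a → a <ℚ b → a *ℚ a <ℚ b *ℚ b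
square-< {a} {b} 0≤a a<b = ℚ.≤-<-trans
  (ℚ.*-monoˡ-≤-nonNeg a {{ℚ.nonNegative 0≤a}} (ℚ.<⇒≤ a<b))
  (ℚ.*-monoˡ-<-pos b {{ℚ.positive (ℚ.≤-<-trans 0≤a a<b)}} a<b)

module _ {q n k m s : ℕ} {{_ : NonTrivial q}} .{{_ : NonZero m}} (k≤n : k ≤ n) where

  instance
    q≢0 : NonZero q
    q≢0 = nonTrivial⇒nonZero q

  D e : ℕ
  D = q ^ (n ∸ k)
  e = D * m ∸ s

  q^ᶻ≡ιD : q ^ᶻ (n ℤ.⊖ k) ≡ ι D
  q^ᶻ≡ιD = cong (q ^ᶻ_) (ℤ.⊖-≥ k≤n)

  -- If t is an upper bound for √(D/m) with s < (1 - t) D m, then the deviation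
  -- exceeds the bound of the second moment: with c = D m and e = c - s,
  -- D² s < D² c = (D/m) c² ≤ (t c)² < e².

  gap⇒large-deviation : ∀ {t} → 0ℚ ≤ℚ t → q ^ᶻ (n ℤ.⊖ k) *ℚ (ℤ.+ 1 / m) ≤ℚ t *ℚ t →
                 ι s +ℚ t *ℚ ι (D * m) <ℚ ι (D * m) → D * D * s < e * e
  gap⇒large-deviation {t} 0≤t rad≤t² s+tc<c = <-trans (*-monoʳ-< (D * D) s<c) (ι-cancel-< (begin-strict
    ι (D * D * c)                                    ≡⟨ radicand ⟨
    (q ^ᶻ (n ℤ.⊖ k) *ℚ (ℤ.+ 1 / m)) *ℚ (ι c *ℚ ι c)  ≤⟨ ℚ.*-monoʳ-≤-nonNeg (ι c *ℚ ι c) rad≤t² ⟩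
    (t *ℚ t) *ℚ (ι c *ℚ ι c)
      ≡⟨ solve 2 (λ t c → (t :* t) :* (c :* c) := (t :* c) :* (t :* c)) refl t (ι c) ⟩
    (t *ℚ ι c) *ℚ (t *ℚ ι c)                         <⟨ square-< 0≤tc tc<e ⟩
    ι e *ℚ ι e                                       ≡⟨ ι-* e e ⟩
    ι (e * e)  ∎))
    where
    open ℚ.≤-Reasoning
    open +-*-Solver
    c : ℕ
    c = D * m

    instance
      D²≢0 : NonZero (D * D)
      D²≢0 = m*n≢0 D D {{m^n≢0 q (n ∸ k)}} {{m^n≢0 q (n ∸ k)}}

      c≥0 : NonNegative (ι c)
      c≥0 = ℚ.normalize-nonNeg c 1

      c²≥0 : NonNegative (ι c *ℚ ι c)
      c²≥0 = subst NonNegative (sym (ι-* c c)) (ℚ.normalize-nonNeg (c * c) 1)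

    0≤tc : 0ℚ ≤ℚ t *ℚ ι c
    0≤tc = subst (_≤ℚ t *ℚ ι c) (ℚ.*-zeroˡ (ι c)) (ℚ.*-monoʳ-≤-nonNeg (ι c) 0≤t)

    s<c : s < c
    s<c = ι-cancel-< (begin-strict
      ι s              ≡⟨ ℚ.+-identityʳ (ι s) ⟨
      ι s +ℚ 0ℚ        ≤⟨ ℚ.+-monoʳ-≤ (ι s) 0≤tc ⟩
      ι s +ℚ t *ℚ ι c  <⟨ s+tc<c ⟩
      ι c              ∎)

    tc<e : t *ℚ ι c <ℚ ι e
    tc<e = ℚ.≰⇒> (λ e≤tc → ℚ.<-irrefl refl (begin-strict
      ι c              ≡⟨ cong ι (m+[n∸m]≡n (<⇒≤ s<c)) ⟨
      ι (s + e)        ≡⟨ ι-+ s e ⟨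
      ι s +ℚ ι e       ≤⟨ ℚ.+-monoʳ-≤ (ι s) e≤tc ⟩
      ι s +ℚ t *ℚ ι c  <⟨ s+tc<c ⟩
      ι c              ∎))

    radicand : (q ^ᶻ (n ℤ.⊖ k) *ℚ (ℤ.+ 1 / m)) *ℚ (ι c *ℚ ι c) ≡ ι (D * D * c)
    radicand = begin-equality
      (q ^ᶻ (n ℤ.⊖ k) *ℚ w) *ℚ (ι c *ℚ ι c)  ≡⟨ cong₂ (λ x y → (x *ℚ w) *ℚ (y *ℚ ι c)) q^ᶻ≡ιD (sym (ι-* D m)) ⟩
      (ι D *ℚ w) *ℚ ((ι D *ℚ ι m) *ℚ ι c)
        ≡⟨ solve 4 (λ d w m c → (d :* w) :* ((d :* m) :* c) := (d :* d :* c) :* (w :* m)) refl (ι D) w (ι m) (ι c) ⟩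
      (ι D *ℚ ι D *ℚ ι c) *ℚ (w *ℚ ι m)      ≡⟨ cong ((ι D *ℚ ι D *ℚ ι c) *ℚ_) (1/n*n≡1 m) ⟩
      (ι D *ℚ ι D *ℚ ι c) *ℚ 1ℚ              ≡⟨ ℚ.*-identityʳ _ ⟩
      ι D *ℚ ι D *ℚ ι c                      ≡⟨ cong (_*ℚ ι c) (ι-* D D) ⟩
      ι (D * D) *ℚ ι c                       ≡⟨ ι-* (D * D) c ⟩
      ι (D * D * c)  ∎
      where
      w : ℚ
      w = ℤ.+ 1 / m

  -- A rational r below the bound comes with t such that D/m ≤ t² and
  -- t < 1 - ε - r/C, where ε = q^(n-2k) and C = m D.  If s ≤ r, then s + t C < C.

  small-deviation⇒bound : e * e ≤ D * D * s → furstenbergBound q n k m ≤ᴿ fromℕ s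
  small-deviation⇒bound e²≤D²s {r} (t , t<gap , 0≤t , rad≤t²) = ℚ.≰⇒> λ s≤r →
    contradiction e²≤D²s (<⇒≱ (gap⇒large-deviation 0≤t rad≤t² (begin-strict
      ι s +ℚ t *ℚ ι c                        ≤⟨ ℚ.+-monoˡ-≤ _ s≤r ⟩
      r +ℚ t *ℚ ι c                          ≡⟨ cong (λ y → r +ℚ t *ℚ y) C≡ ⟨
      r +ℚ t *ℚ C                            <⟨ ℚ.+-monoʳ-< r (ℚ.*-monoˡ-<-pos C t<gap) ⟩
      r +ℚ (1ℚ -ℚ ε -ℚ r *ℚ C⁻¹) *ℚ C
        ≡⟨ solve 4 (λ r ε v C → r :+ (con 1ℚ :- ε :- r :* v) :* C := C :- ε :* C :+ (r :- r :* (C :* v))) refl r ε C⁻¹ C ⟩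
      C -ℚ ε *ℚ C +ℚ (r -ℚ r *ℚ (C *ℚ C⁻¹))  ≡⟨ cong (λ y → C -ℚ ε *ℚ C +ℚ (r -ℚ r *ℚ y)) (ℚ.*-inverseʳ C) ⟩
      C -ℚ ε *ℚ C +ℚ (r -ℚ r *ℚ 1ℚ)
        ≡⟨ solve 3 (λ C x r → C :- x :+ (r :- r :* con 1ℚ) := C :- x) refl C (ε *ℚ C) r ⟩
      C -ℚ ε *ℚ C                            ≤⟨ ℚ.+-monoʳ-≤ C (ℚ.neg-antimono-≤ 0≤εC) ⟩
      C -ℚ 0ℚ                                ≡⟨ ℚ.+-identityʳ C ⟩
      C                                      ≡⟨ C≡ ⟩
      ι c  ∎)))
    where
    open ℚ.≤-Reasoning
    open +-*-Solver
    c : ℕ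
    c = D * m

    C ε : ℚ
    C = ι m *ℚ q ^ᶻ (n ℤ.⊖ k)
    ε = q ^ᶻ (n ℤ.⊖ 2 * k)

    C≡ : C ≡ ι c
    C≡ = trans (cong (ι m *ℚ_) q^ᶻ≡ιD) (trans (ι-* m D) (cong ι (*-comm m D)))

    instance
      C>0 : Positive C
      C>0 = ℚ.pos*pos⇒pos (ι m) {{ℚ.normalize-pos m 1}} (q ^ᶻ (n ℤ.⊖ k)) {{^ᶻ-positive q (n ℤ.⊖ k)}}

      C≢0 : ℚ.NonZero C
      C≢0 = ℚ.pos⇒nonZero C

    C⁻¹ : ℚ
    C⁻¹ = 1/ C

    0≤εC : 0ℚ ≤ℚ ε *ℚ C
    0≤εC = ℚ.<⇒≤ (ℚ.positive⁻¹ (ε *ℚ C) {{ℚ.pos*pos⇒pos ε {{^ᶻ-positive q (n ℤ.⊖ 2 * k)}} C}})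

-- Assembling rich frames

-- Concatenates blocks of N elements, one block for each x.  The relation labels
-- the elements of the block of x by x, and distinct entries of xs have disjoint
-- label classes, so that the concatenation is free of duplicates.

concatBlocks : ∀ {X : Set ℓ} {Y : Set} {N} {P : Y → Set} (_~_ : X → Y → Set) {xs : List X} →
  AllPairs (λ x x′ → ∀ y → x ~ y → ¬ x′ ~ y) xs →
  All (λ x → ∃[ ys ] Unique≡ ys × length ys ≡ N × All (λ y → P y × x ~ y) ys) xs →
  ∃[ ys ] Unique≡ ys × length ys ≡ length xs * N × All (λ y → P y × Any (_~ y) xs) ys
concatBlocks _~_ [] [] = [] , [] , refl , []
concatBlocks _~_ {x ∷ xs} (x#xs ∷ apart) ((ys , ys! , ∣ys∣ , good) ∷ blocks)
  with zs , zs! , ∣zs∣ , goods ← concatBlocks _~_ apart blocks =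
    ys ++ zs
  , Unique≡.++⁺ ys! zs! (λ (y∈ys , y∈zs) → disjoint x#xs (proj₂ (All.lookup good y∈ys)) (proj₂ (All.lookup goods y∈zs)))
  , trans (List.length-++ ys) (cong₂ _+_ ∣ys∣ ∣zs∣)
  , All.++⁺ (All.map (λ (p , r) → p , here r) good) (All.map (λ (p , r) → p , there r) goods)
  where
  disjoint : ∀ {xs y} → All (λ x′ → ∀ y → x ~ y → ¬ x′ ~ y) xs → x ~ y → ¬ Any (_~ y) xs
  disjoint (x# ∷ _)  x~y (here x′~y) = x# _ x~y x′~y
  disjoint (_ ∷ x#s) x~y (there any) = disjoint x#s x~y any

module FurstenbergBound {q : ℕ} {{_ : NonTrivial q}} (F : FiniteField q) (n k m : ℕ) .{{_ : NonZero m}} (k≤n : k ≤ n)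
            (S : PointSet F n) (xs : List (Point F n)) (xs! : Unique≡ xs) (xs≡S : ∀ x → x ∈ xs ⇔ S x) where

  open LinearAlgebra F
  open FiniteField F using () renaming (Carrier to 𝔽)
  open Finite
  open Counting F n

  1<q : 1 < q
  1<q = nonTrivial⇒n>1 q

  open Bases k 1<q k≤n
  open Incidences F n k 1<q k≤n xs xs!

  -- An independent frame whose flat has at least m points in S.

  Rich : Frame → Set
  Rich fr = Independent (proj₁ fr) × m ≤ hits fr

  rich-frame : ∀ {A : PointSet F n} fr → (∀ {x} → A x → flat fr x) → HasAtLeast (A ∩ S) m → m ≤ hits fr
  rich-frame fr A⊆ (ys , ys! , ∣ys∣ , ys⊆) = common-points≤hits fr A⊆
    (ys , ys! , ∣ys∣ , All.map (λ (Ax , Sx) → Ax , Equivalence.from (xs≡S _) Sx) ys⊆)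

  manyRichFrames⇒bound : (R : List Frame) → Unique≡ R → All Rich R → K * #bases ≤ length R →
    furstenbergBound q n k m ≤ᴿ fromℕ (length xs)
  manyRichFrames⇒bound R R! good many = small-deviation⇒bound k≤n (deviation-bound R R! good many)

  -- The invertible k × k matrices, as independent tuples of rows.

  open Counting F k using () renaming (independentTuples to matrices; length-independentTuples to length-matrices;
    unique-independentTuples to unique-matrices; ∈-independentTuples⁻ to ∈-matrices⁻)

  lc-composite : ∀ (vs : Vec (Point F n) k) a c {j} (d : Vec 𝔽 j) (M : Vec (Vec 𝔽 k) j) →
    (a ⊞ lc c vs) ⊞ lc d (Vec.map (λ r → lc r vs) M) ≡ a ⊞ lc (c ⊞ lc d M) vs
  lc-composite vs a c d M = begin
    (a ⊞ lc c vs) ⊞ lc d (Vec.map (λ r → lc r vs) M)  ≡⟨ ⊞-assoc a _ _ ⟩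
    a ⊞ (lc c vs ⊞ lc d (Vec.map (λ r → lc r vs) M))  ≡⟨ cong (λ x → a ⊞ (lc c vs ⊞ x)) (lc-map-lc d M vs) ⟩
    a ⊞ (lc c vs ⊞ lc (lc d M) vs)                    ≡⟨ cong (a ⊞_) (lc-⊞ c (lc d M) vs) ⟨
    a ⊞ lc (c ⊞ lc d M) vs                            ∎
    where open ≡-Reasoning

  -- A change of basis by an invertible matrix and a change of base point within the
  -- flat do not change the flat.  That the new frame reaches all points uses that
  -- the injective map e ↦ lc e M of a finite set is surjective.

  flat-reframe : ∀ {vs : Vec (Point F n) k} {M : Vec (Vec 𝔽 k) k} → Independent M → ∀ a c →
    flat (vs , a) ≐ flat (Vec.map (λ r → lc r vs) M , a ⊞ lc c vs)
  flat-reframe {vs} {M} ind a c = to , from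
    where
    to : ∀ {x} → flat (vs , a) x → flat (Vec.map (λ r → lc r vs) M , a ⊞ lc c vs) x
    to (d , refl) with e , eq ← injective⇒surjective (finiteVec k) (λ e → lc e M) (lc-injective ind) (d ⊞ ⊟ c) =
      e , sym (trans (lc-composite vs a c e M)
            (cong (λ y → a ⊞ lc y vs) (trans (cong (c ⊞_) (sym eq)) (v+[u-v]≡u d c))))
    from : ∀ {x} → flat (Vec.map (λ r → lc r vs) M , a ⊞ lc c vs) x → flat (vs , a) x
    from (d , refl) = c ⊞ lc d M , lc-composite vs a c d M

  IsFlat⇒frame : ∀ {A} → IsFlat F k A → ∃[ fr ] Independent (proj₁ fr) × A ≐ flat fr
  IsFlat⇒frame (a , W , W-sub , A≐) = (basis , a) , basis-independent
    , (λ Ax → let w , Ww , x≡ = proj₁ A≐ Ax ; c , w≡ = proj₁ basis-spans Ww in c , trans x≡ (cong (a ⊞_) w≡))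
    , (λ (c , x≡) → proj₂ A≐ (lc c basis , proj₂ basis-spans (c , refl) , x≡))
    where open IsSubspace W-sub

  map-injective : ∀ {A B : Set} {f : A → B} → (∀ {x y} → f x ≡ f y → x ≡ y) →
    ∀ {j} {us ws : Vec A j} → Vec.map f us ≡ Vec.map f ws → us ≡ ws
  map-injective inj {us = []}     {[]}     _  = refl
  map-injective inj {us = u ∷ us} {w ∷ ws} eq = cong₂ _∷_ (inj (Vec.∷-injectiveˡ eq)) (map-injective inj (Vec.∷-injectiveʳ eq))

  -- All frames spanning the flat of a given independent frame.

  framesOfFlat : Frame → List Frame
  framesOfFlat (vs , a) = cartesianProductWith (λ M c → Vec.map (λ r → lc r vs) M , a ⊞ lc c vs) (matrices k) cs

  framesOfFlat-unique : ∀ fr → Independent (proj₁ fr) → Unique≡ (framesOfFlat fr)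
  framesOfFlat-unique (vs , a) ind = Unique≡.cartesianProductWith⁺ _
    (λ {M} {M′} {c} {c′} eq → map-injective (lc-injective ind) (cong proj₁ eq) ,
      lc-injective ind (⊞-cancelˡ a (lc c vs) (lc c′ vs) (cong proj₂ eq)))
    (unique-matrices k) (unique (finiteVec k))

  length-framesOfFlat : ∀ fr → length (framesOfFlat fr) ≡ tupleCount q k 0 k * K
  length-framesOfFlat (vs , a) = trans (length-cartesianProductWith _ (matrices k) cs)
    (cong₂ _*_ (length-matrices k) (length-coefficients k))

  ∈-framesOfFlat⁻ : ∀ fr → Independent (proj₁ fr) → ∀ {fr′} → fr′ ∈ framesOfFlat fr →
    Independent (proj₁ fr′) × flat fr ≐ flat fr′
  ∈-framesOfFlat⁻ (vs , a) ind fr′∈ with ∈-cartesianProductWith⁻ _ (matrices k) cs fr′∈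
  ... | M , c , M∈ , _ , refl = let ind-M = ∈-matrices⁻ M∈ in
    independent-map-lc {ms = M} {vs} ind-M ind , flat-reframe ind-M a c

  -- Each flat contributes all its frames, labelled by the flat.

  richFlats⇒bound : (L : List (PointSet F n)) → Unique (≐-setoid (Point F n) 0ℓ) L →
    All (IsFlat F k) L → All (λ A → HasAtLeast (A ∩ S) m) L →
    length L ≡ qBinomial q n k → furstenbergBound q n k m ≤ᴿ fromℕ (length xs)
  richFlats⇒bound L L! flats rich-L ∣L∣ =
    let R , R! , ∣R∣ , good = concatBlocks {P = Rich} (λ A fr → A ≐ flat fr)
          (AllPairs.map (λ A≢B _ A≐ B≐ → A≢B (≐-trans A≐ (≐-sym B≐))) L!)
          (All.zipWith block (flats , rich-L))
    in manyRichFrames⇒bound R R! (All.map proj₁ good) (≤-reflexive (begin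
      K * #bases                                  ≡⟨ cong (K *_) (GaussianBinomial.qBinomial-tupleCount q k≤n) ⟨
      K * (qBinomial q n k * tupleCount q k 0 k)  ≡⟨ *-comm K _ ⟩
      qBinomial q n k * tupleCount q k 0 k * K    ≡⟨ *-assoc (qBinomial q n k) _ K ⟩
      qBinomial q n k * (tupleCount q k 0 k * K)  ≡⟨ cong (_* _) ∣L∣ ⟨
      length L * (tupleCount q k 0 k * K)         ≡⟨ ∣R∣ ⟨
      length R                                    ∎))
    where
    open ≡-Reasoning
    block : ∀ {A} → IsFlat F k A × HasAtLeast (A ∩ S) m →
      ∃[ R ] Unique≡ R × length R ≡ tupleCount q k 0 k * K × All (λ fr → Rich fr × A ≐ flat fr) R
    block (A-flat , A-rich) with fr , ind , A≐ ← IsFlat⇒frame A-flat =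
      framesOfFlat fr , framesOfFlat-unique fr ind , length-framesOfFlat fr
      , All.tabulate (λ {fr′} fr′∈ → let ind′ , eq = ∈-framesOfFlat⁻ fr ind fr′∈ ; A≐′ = ≐-trans A≐ eq in
          (ind′ , rich-frame fr′ (proj₁ A≐′) A-rich) , A≐′)

  span : Vec (Point F n) k → PointSet F n
  span vs v = ∃[ c ] v ≡ lc c vs

  span-isSubspace : ∀ {vs} → Independent vs → IsSubspace F k (span vs)
  span-isSubspace {vs} ind = record
    { 0ᵛ-mem            = 𝟎 , sym (lc-𝟎 vs)
    ; +ᵛ-closed         = λ (c , u≡) (d , v≡) → c ⊞ d , trans (cong₂ _⊞_ u≡ v≡) (sym (lc-⊞ c d vs))
    ; ·ᵛ-closed         = λ a (c , v≡) → a · c , trans (cong (a ·_) v≡) (sym (lc-· a c vs))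
    ; basis             = vs
    ; basis-independent = ind
    ; basis-spans       = (λ x → x) , (λ x → x)
    }

  -- Each basis vs contributes the frames (vs, a′) with a′ running over the points of
  -- a translate of its span with m points in S, labelled by vs.

  furstenberg⇒bound : IsFurstenberg F k m S → furstenbergBound q n k m ≤ᴿ fromℕ (length xs)
  furstenberg⇒bound furstenberg =
    let R , R! , ∣R∣ , good = concatBlocks {P = Rich} (λ vs fr → vs ≡ proj₁ fr)
          (AllPairs.map (λ vs≢ws _ vs≡ ws≡ → vs≢ws (trans vs≡ (sym ws≡))) (unique-independentTuples k))
          (All.tabulate block)
    in manyRichFrames⇒bound R R! (All.map proj₁ good) (≤-reflexive (begin
      K * #bases        ≡⟨ *-comm K #bases ⟩
      #bases * K        ≡⟨ cong (_* K) (length-independentTuples k) ⟨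
      length bases * K  ≡⟨ ∣R∣ ⟨
      length R          ∎))
    where
    open ≡-Reasoning
    block : ∀ {vs} → vs ∈ bases →
      ∃[ R ] Unique≡ R × length R ≡ K × All (λ fr → Rich fr × vs ≡ proj₁ fr) R
    block {vs} vs∈ with ind ← ∈-independentTuples⁻ vs∈
                   with a , a-rich ← furstenberg (span vs) (span-isSubspace ind) =
        map frame cs
      , Unique≡.map⁺
          (λ {c} {c′} eq → lc-injective ind (⊞-cancelˡ a (lc c vs) (lc c′ vs) (cong proj₂ eq)))
          (unique (finiteVec k))
      , trans (List.length-map frame cs) (length-coefficients k)
      , All.map⁺ (All.tabulate (λ {c} _ → (ind , rich-frame (frame c) (translate⊆flat c) a-rich) , refl))
      where
      frame : Vec 𝔽 k → Frame
      frame c = vs , a ⊞ lc c vs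
      translate⊆flat : ∀ c {x} → translate F a (span vs) x → flat (frame c) x
      translate⊆flat c (_ , (d , refl) , refl) = d ⊞ ⊟ c , sym (begin
        (a ⊞ lc c vs) ⊞ lc (d ⊞ ⊟ c) vs  ≡⟨ ⊞-assoc a _ _ ⟩
        a ⊞ (lc c vs ⊞ lc (d ⊞ ⊟ c) vs)  ≡⟨ cong (a ⊞_) (lc-⊞ c (d ⊞ ⊟ c) vs) ⟨
        a ⊞ lc (c ⊞ (d ⊞ ⊟ c)) vs        ≡⟨ cong (λ y → a ⊞ lc y vs) (v+[u-v]≡u d c) ⟩
        a ⊞ lc d vs                      ∎)

theorem3 : ∀ {q : ℕ} (pp : PrimePower q) (F : FiniteField q)
    (n k m : ℕ) .{{_ : NonZero m}} → n < 2 * k → k < n → m ≤ q ^ k →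
    let bound = furstenbergBound q n k m {{primePower⇒nonTrivial pp}} in
    (∀ (S : PointSet F n) (s : ℕ) → HasSize S s →
    ∀ (L : List (PointSet F n)) → Unique (≐-setoid (Point F n) 0ℓ) L →
    All (IsFlat F k) L → All (λ A → HasAtLeast (A ∩ S) m) L →
    length L ≡ qBinomial q n k {{primePower⇒nonTrivial pp}} →
    bound ≤ᴿ fromℕ s)
    × (∀ (t : ℕ) → IsK F n k m t → bound ≤ᴿ fromℕ t)
theorem3 pp F n k m _ k<n _ =
    (λ { S s (xs , xs! , refl , xs≡S) → FurstenbergBound.richFlats⇒bound F n k m (<⇒≤ k<n) S xs xs! xs≡S })
  , (λ { t record { attained = S , (xs , xs! , refl , xs≡S) , furstenberg } →
           FurstenbergBound.furstenberg⇒bound F n k m (<⇒≤ k<n) S xs xs! xs≡S furstenberg })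
  where
  instance
    q-nonTrivial : NonTrivial _
    q-nonTrivial = primePower⇒nonTrivial pp
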